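{- Suppose that for some fixed constant $\epsilon_0\in(0,\tfrac14]$ there is an algorithm that, given distance query access to a $(1,2)$-TSP instance on $N$ points, estimates its cost within a $(\tfrac32-\epsilon_0)$-factor (i.e., outputs $\tilde{\tau}$ with $\tau\le\tilde{\tau}\le(\tfrac32-\epsilon_0)\tau$, where $\tau$ is the optimal tour cost) in $N^{1+o(1)}$ time. Then, for some constant $\epsilon>0$ (depending on $\epsilon_0$), there is an $n^{1+o(1)}$-time algorithm that, given adjacency matrix access to a bipartite graph $G=(L,R,E)$ with $|L|=|R|=n$ that is promised to satisfy either $\mu(G)=n$ or $\mu(G)=(\tfrac12+\epsilon)n/2$, distinguishes between these two cases.
   Context: A $(1,2)$-TSP instance is a set of $N$ points with a symmetric distance function taking values in $\{1,2\}$ on distinct pairs; the algorithm may query any distance; the cost is the minimum total distance of a Hamiltonian cycle. $\mu(G)$ denotes the maximum matching size of $G$. Adjacency matrix access means the algorithm may query whether any given pair of vertices forms an edge. -}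

module Defs where

open import Data.Bool using (Bool; true; false; if_then_else_)
open import Data.Fin using (Fin; zero; suc; toℕ; inject₁; fromℕ; splitAt)
open import Data.Fin.Permutation using (Permutation′; _⟨$⟩ʳ_)
open import Data.Integer using (+_)
open import Data.List using (List; _∷_; length; map)
open import Data.List.Relation.Unary.All using (All)
open import Data.List.Relation.Unary.Unique.Propositional using (Unique)
open import Data.Nat using (ℕ; zero; suc; _+_; _*_; _∸_; _^_; _≤_; _<_; _≡ᵇ_; NonZero)
import Data.Nat.DivMod as ℕ/
open import Data.Nat.Properties using (+-0-commutativeMonoid)
open import Data.Product using (Σ-syntax; ∃-syntax; _×_; proj₁; proj₂)
open import Data.Rational as ℚ using (ℚ; _/_; ½)
open import Data.Sum using (_⊎_; inj₁; inj₂)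
open import Data.Unit using (⊤)
open import Data.Vec using (Vec; toList)
open import Relation.Binary.PropositionalEquality using (_≡_; _≢_)
import Algebra.Properties.CommutativeMonoid.Sum

open Algebra.Properties.CommutativeMonoid.Sum +-0-commutativeMonoid using (sum)

fromNat : ℕ → ℚ
fromNat n = + n / 1

-- Randomised word RAM with oracle access.
--
-- A command is a finite program over registers (indexed by ℕ) and an
-- indirectly addressed memory.  Comparisons and remainders are obtained from
-- truncated subtraction and division.

Reg : Set
Reg = ℕ

data Op : Set where
  add sub mul div : Op

⟦_⟧ : Op → ℕ → ℕ → ℕ
⟦ add ⟧ a b       = a + b
⟦ sub ⟧ a b       = a ∸ b
⟦ mul ⟧ a b       = a * b
⟦ div ⟧ a zero    = 0
⟦ div ⟧ a (suc b) = a ℕ/./ suc b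

data Cmd : Set where
  skip   : Cmd
  const  : (x : Reg) (k : ℕ) → Cmd
  arith  : (o : Op) (x y z : Reg) → Cmd
  load   : (x y : Reg) → Cmd
  store  : (x y : Reg) → Cmd
  flip   : (x : Reg) → Cmd
  query  : (x y z : Reg) → Cmd
  _⨾_    : Cmd → Cmd → Cmd
  ifnz   : (x : Reg) → Cmd → Cmd → Cmd
  while  : (x : Reg) → Cmd → Cmd

infixr 5 _⨾_

_[_↦_] : (ℕ → ℕ) → ℕ → ℕ → (ℕ → ℕ)
(f [ x ↦ v ]) y = if x ≡ᵇ y then v else f y

bit : Bool → ℕ
bit b = if b then 1 else 0

record State : Set where
  constructor ⟨_,_,_⟩
  field
    regs  : ℕ → ℕ
    mem   : ℕ → ℕ
    coins : List Bool
open State public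

Oracle : ℕ → Set
Oracle m = Fin m → Fin m → ℕ

-- Run O W P s s′ t : started in s, the command P halts in s′ after t unit-cost
-- steps.  Constants and results of arithmetic have to be smaller than W, and
-- both arguments of a query have to be valid indices; otherwise the machine is
-- stuck, so that no derivation exists.  All remaining values written are copies
-- of earlier ones, random bits, or answers of the oracle (which lie in {0,1,2}
-- for the oracles used below).

data Run {m : ℕ} (O : Oracle m) (W : ℕ) : Cmd → State → State → ℕ → Set where
  run-skip  : ∀ {s} → Run O W skip s s 1
  run-const : ∀ {x k r h ω} → k < W →
              Run O W (const x k) ⟨ r , h , ω ⟩ ⟨ r [ x ↦ k ] , h , ω ⟩ 1
  run-arith : ∀ {o x y z r h ω} → ⟦ o ⟧ (r y) (r z) < W →
              Run O W (arith o x y z) ⟨ r , h , ω ⟩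
                                      ⟨ r [ x ↦ ⟦ o ⟧ (r y) (r z) ] , h , ω ⟩ 1
  run-load  : ∀ {x y r h ω} →
              Run O W (load x y) ⟨ r , h , ω ⟩ ⟨ r [ x ↦ h (r y) ] , h , ω ⟩ 1
  run-store : ∀ {x y r h ω} →
              Run O W (store x y) ⟨ r , h , ω ⟩ ⟨ r , h [ r x ↦ r y ] , ω ⟩ 1
  run-flip  : ∀ {x b r h ω} →
              Run O W (flip x) ⟨ r , h , b ∷ ω ⟩ ⟨ r [ x ↦ bit b ] , h , ω ⟩ 1
  run-query : ∀ {x y z r h ω} (i j : Fin m) → toℕ i ≡ r y → toℕ j ≡ r z →
              Run O W (query x y z) ⟨ r , h , ω ⟩ ⟨ r [ x ↦ O i j ] , h , ω ⟩ 1
  run-seq   : ∀ {P Q s s′ s″ t u} → Run O W P s s′ t → Run O W Q s′ s″ u →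
              Run O W (P ⨾ Q) s s″ (t + u)
  run-then  : ∀ {x P Q s s′ t} → regs s x ≢ 0 → Run O W P s s′ t →
              Run O W (ifnz x P Q) s s′ (suc t)
  run-else  : ∀ {x P Q s s′ t} → regs s x ≡ 0 → Run O W Q s s′ t →
              Run O W (ifnz x P Q) s s′ (suc t)
  run-loop  : ∀ {x P s s′ s″ t u} → regs s x ≢ 0 →
              Run O W P s s′ t → Run O W (while x P) s′ s″ u →
              Run O W (while x P) s s″ (suc (t + u))
  run-done  : ∀ {x P s} → regs s x ≡ 0 → Run O W (while x P) s s 1

-- The size parameter is initially in register 0; everything else is 0.
init : ℕ → List Bool → State
init n ω = ⟨ (λ _ → 0) [ 0 ↦ n ] , (λ _ → 0) , ω ⟩

-- Correct I r: the final register contents r are a correct output on I.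
record Problem : Set₁ where
  field
    Instance : ℕ → Set
    points   : ℕ → ℕ
    oracle   : ∀ {n} → Instance n → Oracle (points n)
    Correct  : ∀ {n} → Instance n → (ℕ → ℕ) → Set

-- T n ≤ n^(1+o(1)), i.e. T n ≤ n^(1+1/k) eventually, for every k ≥ 1.
AlmostLinear : (ℕ → ℕ) → Set
AlmostLinear T = ∀ k → 1 ≤ k → ∃[ n₀ ] ∀ n → n₀ ≤ n → T n ^ k ≤ n ^ suc k

-- The event A has probability at least p under t independent fair coins.
ProbAtLeast : ℚ → (t : ℕ) → (Vec Bool t → Set) → Set
ProbAtLeast p t A =
  ∃[ S ] Unique S × All A S × p ℚ.* fromNat (2 ^ t) ℚ.≤ fromNat (length S)

-- The running time T n is worst case over instances and coins.  As each coin
-- flip takes one step, T n coins always suffice.  Words have c·log₂(n+2) bits.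
record Algorithm (p : ℚ) (Π : Problem) : Set where
  open Problem Π
  field
    program : Cmd
    c       : ℕ
    T       : ℕ → ℕ
    time    : AlmostLinear T

  HaltsWith : ∀ {n} → Instance n → ((ℕ → ℕ) → Set) → Vec Bool (T n) → Set
  HaltsWith {n} I Good ω =
    ∃[ s ] ∃[ t ] Run (oracle I) ((n + 2) ^ c) program (init n (toList ω)) s t
                  × t ≤ T n × Good (regs s)

  field
    halts   : ∀ {n} (I : Instance n) ω → HaltsWith I (λ _ → ⊤) ω
    correct : ∀ {n} (I : Instance n) → ProbAtLeast p (T n) (HaltsWith I (Correct I))

record OneTwoTSP (N : ℕ) : Set where
  field
    d     : Fin N → Fin N → ℕ
    d-ii  : ∀ i → d i i ≡ 0
    d-sym : ∀ i j → d i j ≡ d j i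
    d-12  : ∀ i j → i ≢ j → d i j ≡ 1 ⊎ d i j ≡ 2

-- Length of the closed tour π 0, π 1, …, π (N-1), π 0.
tourCost : ∀ {N} → (Fin N → Fin N → ℕ) → Permutation′ N → ℕ
tourCost {zero}  d π = 0
tourCost {suc m} d π =
  sum (λ (i : Fin m) → d (π ⟨$⟩ʳ inject₁ i) (π ⟨$⟩ʳ suc i))
  + d (π ⟨$⟩ʳ fromℕ m) (π ⟨$⟩ʳ zero)

IsOptimalCost : ∀ {N} → OneTwoTSP N → ℕ → Set
IsOptimalCost X τ = (∃[ π ] tourCost d π ≡ τ) × (∀ π → τ ≤ tourCost d π)
  where open OneTwoTSP X

-- The estimate is the rational number (register 0) / (register 1).
-- Hamiltonian cycles require at least three points.
TSPEstimation : ℚ → Problem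
TSPEstimation ratio = record
  { Instance = λ N → 3 ≤ N × OneTwoTSP N
  ; points   = λ N → N
  ; oracle   = λ I → OneTwoTSP.d (proj₂ I)
  ; Correct  = λ I out →
      ∃[ τ ] IsOptimalCost (proj₂ I) τ ×
      (Σ[ nz ∈ NonZero (out 1) ]
        let τ̃ = _/_ (+ out 0) (out 1) {{nz}} in
        fromNat τ ℚ.≤ τ̃ × τ̃ ℚ.≤ ratio ℚ.* fromNat τ)
  }

-- E of a bipartite graph (L , R , E) with L = R = Fin n.
BipartiteGraph : ℕ → Set
BipartiteGraph n = Fin n → Fin n → Bool

-- Adjacency matrix on L ⊎ R, where L consists of the first n of the n + n
-- vertices.
adjacency : ∀ {n} → BipartiteGraph n → Fin (n + n) → Fin (n + n) → Bool
adjacency {n} E u v with splitAt n u | splitAt n v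
... | inj₁ l | inj₂ r = E l r
... | inj₂ r | inj₁ l = E l r
... | inj₁ _ | inj₁ _ = false
... | inj₂ _ | inj₂ _ = false

record IsMatching {n} (E : BipartiteGraph n) (M : List (Fin n × Fin n)) : Set where
  field
    edges   : All (λ e → E (proj₁ e) (proj₂ e) ≡ true) M
    uniqueˡ : Unique (map proj₁ M)
    uniqueʳ : Unique (map proj₂ M)

-- m = μ(E)
IsMatchingNumber : ∀ {n} → BipartiteGraph n → ℕ → Set
IsMatchingNumber E m =
  (∃[ M ] IsMatching E M × length M ≡ m) × (∀ M → IsMatching E M → length M ≤ m)

HasPerfect : ∀ {n} → BipartiteGraph n → Set
HasPerfect {n} E = IsMatchingNumber E n

-- μ(E) = (1/2 + ε) n / 2
HasSmall : ℚ → ∀ {n} → BipartiteGraph n → Set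
HasSmall ε {n} E =
  ∃[ m ] IsMatchingNumber E m × fromNat m ≡ (½ ℚ.+ ε) ℚ.* (+ n / 2)

-- Register 0 finally holds 1 if μ = n and 0 if μ = (1/2 + ε) n / 2.  For n = 0
-- the two cases coincide, hence 1 ≤ n.
MatchingGap : ℚ → Problem
MatchingGap ε = record
  { Instance = λ n → 1 ≤ n × (Σ[ E ∈ BipartiteGraph n ] (HasPerfect E ⊎ HasSmall ε E))
  ; points   = λ n → n + n
  ; oracle   = λ I u v → bit (adjacency (proj₁ (proj₂ I)) u v)
  ; Correct  = λ I out →
      let E = proj₁ (proj₂ I) in
      (HasPerfect E → out 0 ≡ 1) × (HasSmall ε E → out 0 ≡ 0)
  }

{-# OPTIONS --safe #-}

-- Replace every vertex of the bipartite graph by h copies and give two copies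
-- distance 1 exactly if their vertices are adjacent.  If the graph has a perfect
-- matching, then traversing its edges one after the other, alternating between
-- the copies of the two ends, gives a tour of N = 2hn points with at most n + 1
-- steps of length 2.  In general, the 2μ endpoints of a maximum matching form a
-- vertex cover, so a tour has at most 2 · h · 2μ steps of length 1 and costs at
-- least 2N − 4hμ, which is (3/2 − ε) N if μ = (1/2 + ε) n / 2.  For h large
-- enough a (3/2 − ε₀)-estimate separates the two cases.  One distance query costs
-- one adjacency query and O(1) arithmetic, so the estimator can be run on the
-- blow-up by translating its program instruction by instruction.

module Submission where

open import Defs
import Algebra.Properties.CommutativeMonoid.Sum as Sum
open import Data.Bool using (Bool; true; false; if_then_else_)
import Data.Bool as Bool using (T)
open import Data.Fin
  using ( Fin; zero; suc; toℕ; inject₁; fromℕ; fromℕ<; cast; splitAt; _↑ˡ_; _↑ʳ_; combine; quotient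
        ; remainder; punchOut)
open import Data.Fin.Permutation using (Permutation′; permutation; _⟨$⟩ʳ_; _⟨$⟩ˡ_; inverseˡ; inverseʳ)
open import Data.Fin.Properties
  using ( _≟_; any?; toℕ-combine; toℕ-injective; toℕ-inject₁; toℕ<n; toℕ-cast; toℕ-fromℕ<; toℕ-↑ˡ; toℕ-↑ʳ
        ; splitAt-↑ˡ; splitAt-↑ʳ; combine-remQuot; remQuot-combine; combine-injective; punchOut-injective
        ; injective⇒≤)
import Data.Integer as ℤ using (+_; -[1+_]; _+_; _≤_; +≤+; +<+)
import Data.Integer.Properties as ℤ using (drop‿+≤+; pos-*)
open import Data.List using (List; []; _∷_; length; map; lookup; cartesianProductWith)
import Data.List as List using (_++_)
open import Data.List.Membership.Propositional.Properties using (∈-lookup; ∈-map⁺)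
open import Data.List.Properties using (length-++; length-map)
open import Data.List.Relation.Unary.All using (All; []; _∷_)
import Data.List.Relation.Unary.All as All using (lookup)
import Data.List.Relation.Unary.All.Properties as All using (cartesianProductWith⁺)
open import Data.List.Relation.Unary.AllPairs using ([]; _∷_)
open import Data.List.Relation.Unary.Unique.Propositional using (Unique)
import Data.List.Relation.Unary.Unique.Propositional.Properties as Unique using (cartesianProductWith⁺)
open import Data.Nat
  using ( ℕ; zero; suc; _+_; _*_; _∸_; _^_; _⊔_; _≤_; _<_; _≡ᵇ_; z≤n; s≤s; NonZero; >-nonZero)
import Data.Nat as ℕ using (_/_)
open import Data.Nat.Divisibility using (m∣m*n)
open import Data.Nat.DivMod
  using ( _%_; m/n≤m; m/n*n≤m; m%n≡m∸m/n*n; [m+kn]%n≡m%n; m<n⇒m%n≡m; m<n⇒m/n≡0; +-distrib-/-∣ˡ; m*n/n≡m)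
open import Data.Nat.Properties
  using ( *-assoc; *-comm; *-distribʳ-+; *-distribˡ-+; *-identityʳ; *-identityˡ; *-mono-<; *-monoʳ-≤; *-monoˡ-<
        ; *-monoˡ-≤; *-zeroʳ; +-0-commutativeMonoid; +-assoc; +-cancelʳ-≡; +-cancelʳ-≤; +-comm; +-identityʳ
        ; +-mono-<; +-mono-≤; +-monoʳ-≤; +-monoˡ-≤; +-suc; 1+n≢0; 1+n≢n; 1+n≰n; <-trans; <-≤-trans; <⇒≤; <⇒≱
        ; [m*n]*[o*p]≡[m*o]*[n*p]; ^-distribˡ-+-*; ^-monoʳ-≤; ^-monoˡ-≤; ^-zeroˡ; even≢odd; m+n≡0⇒m≡0; m+n≡0⇒n≡0
        ; m<m+n; m>n⇒m∸n≢0; m∸n≡0⇒m≤n; m∸n≤m; m≤m*n; m≤m+n; m≤m⊔n; m≤n*m; m≤n+m; m≤n⊔m; m≤n⇒m∸n≡0; n∸n≡0; n≤1+n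
        ; ≡⇒≡ᵇ; ≤-<-trans; ≤-antisym; ≤-refl; ≤-reflexive; ≤-trans; ≤∧≢⇒<; ≮⇒≥; ⊔-identityʳ; module ≤-Reasoning)
open import Data.Nat.Tactic.RingSolver using (solve-∀)
open import Data.Product using (Σ-syntax; ∃-syntax; _×_; _,_; proj₁; proj₂)
open import Data.Rational using (ℚ; mkℚ; 0ℚ; 1ℚ; ½; _/_; toℚᵘ; *<*)
import Data.Rational as ℚ using (_+_; _-_; -_; _*_; _≤_; _<_; NonNegative)
import Data.Rational.Properties as ℚ
  using ( *-assoc; *-monoʳ-≤-nonNeg; +-assoc; +-identityʳ; +-inverseʳ; +-monoʳ-≤; +-monoˡ-≤; normalize-nonNeg
        ; normalize-pos; positive⁻¹; toℚᵘ-cancel-≤; toℚᵘ-fromℚᵘ; toℚᵘ-homo-*; toℚᵘ-homo-+; toℚᵘ-injective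
        ; toℚᵘ-mono-≤; ≤-antisym; ≤-reflexive; ≤-trans; ≰⇒>; module ≤-Reasoning)
open import Data.Rational.Unnormalised using (mkℚᵘ; *≤*)
import Data.Rational.Unnormalised as ℚᵘ using (_≃_)
import Data.Rational.Unnormalised.Properties as ℚᵘ
  using (*-cong; +-cong; ≃-reflexive; ≃-sym; ≃-trans; ≤-respʳ-≃; ≤-respˡ-≃)
open import Data.Sum using (_⊎_; inj₁; inj₂)
open import Data.Unit using (⊤; tt)
open import Data.Vec using (Vec; []; _∷_; _++_; toList; take; drop)
import Data.Vec.Properties as Vec using (++-injective; take++drop≡id; toList-++; ∷-injective)
open import Function using (_∘_)
open import Relation.Binary.PropositionalEquality
  using (_≡_; _≢_; refl; sym; trans; cong; cong₂; subst; subst₂; setoid; module ≡-Reasoning)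
open import Relation.Nullary using (yes; no; does; contradiction)
open import Relation.Nullary.Decidable using (dec-true; dec-false)

open Sum +-0-commutativeMonoid using (sum; sum-cong-≗; sum-init-last; sum-permute; ∑-distrib-+)

-- Sums over Fin

-- Let 1/b ≤ ε₀, ε = 1/2b and N = 2hn. In the perfect case the estimate is at most (3/2 - 1/b)(N +
-- 2n), in the small case at least (3/2 - 1/2b) N. These ranges are disjoint as soon as h > 3b - 2.
-- So h is a constant, N is linear in n, and almost linear time in N is almost linear time in n.
--
-- The machine model shapes the rest. A run exists only while all arithmetic results stay below the
-- word bound, so the translated program needs a larger bound, still polynomial in n. The critical
-- values are the products in the final comparison: they involve the two output registers of the
-- estimator, about which only its own run gives information. Every value in that run is bounded by
-- its word bound, its input size or an oracle answer, and this fixes the exponent of the new word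
-- size. The comparison is cross-multiplied and stays within natural numbers. The slower program is
-- also allotted more coins than the estimator; they form a suffix that the run never reaches, and
-- the success probability is unaffected.

sum-mono : ∀ {n} {f g : Fin n → ℕ} → (∀ i → f i ≤ g i) → sum f ≤ sum g
sum-mono {zero}  f≤g = z≤n
sum-mono {suc n} f≤g = +-mono-≤ (f≤g zero) (sum-mono (f≤g ∘ suc))

sum-const : ∀ n c → sum {n} (λ _ → c) ≡ n * c
sum-const zero    c = refl
sum-const (suc n) c = cong (c +_) (sum-const n c)

sum-0 : ∀ n → sum {n} (λ _ → 0) ≡ 0
sum-0 n = trans (sum-const n 0) (*-zeroʳ n)

sum-↑ : ∀ m {n} (f : Fin (m + n) → ℕ) → sum f ≡ sum (f ∘ (_↑ˡ n)) + sum (f ∘ (m ↑ʳ_))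
sum-↑ zero    f = refl
sum-↑ (suc m) f = trans (cong (f zero +_) (sum-↑ m (f ∘ suc))) (sym (+-assoc (f zero) _ _))

sum-combine : ∀ n {k} (f : Fin (n * k) → ℕ) →
              sum f ≡ sum (λ (i : Fin n) → sum (λ (j : Fin k) → f (combine i j)))
sum-combine zero        f = refl
sum-combine (suc n) {k} f =
  trans (sum-↑ k f) (cong (sum (f ∘ (_↑ˡ (n * k))) +_) (sum-combine n (f ∘ (k ↑ʳ_))))

-- Bounds on tour costs

≢-cong-⟨$⟩ʳ : ∀ {N} (π : Permutation′ N) {x y} → x ≢ y → π ⟨$⟩ʳ x ≢ π ⟨$⟩ʳ y
≢-cong-⟨$⟩ʳ π x≢y eq =
  x≢y (trans (sym (inverseˡ π)) (trans (cong (π ⟨$⟩ˡ_) eq) (inverseˡ π)))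

-- Every point is an end of exactly two steps of the tour, so summing the hypothesis over all steps
-- counts each charge `κ` twice. At least two points are required for the ends of every step to
-- differ.
tourCost-lower : ∀ {N} (d : Fin N → Fin N → ℕ) (κ : Fin N → ℕ) → 2 ≤ N →
                 (∀ u v → u ≢ v → 2 ≤ d u v + (κ u + κ v)) →
                 ∀ π → 2 * N ≤ tourCost d π + 2 * sum κ
tourCost-lower {suc (suc m)} d κ _ step π = begin
  2 * suc (suc m)                                ≡⟨ *-comm 2 (suc (suc m)) ⟩
  suc (suc m) * 2                                ≡⟨ +-comm 2 (suc m * 2) ⟩
  suc m * 2 + 2                                  ≡⟨ cong (_+ 2) (sum-const (suc m) 2) ⟨
  sum {suc m} (λ _ → 2) + 2                      ≤⟨ +-mono-≤ (sum-mono λ i →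
                                                      step _ _ (≢-cong-⟨$⟩ʳ π (inject₁≢suc i)))
                                                      (step _ _ (≢-cong-⟨$⟩ʳ π λ ())) ⟩
  sum (λ i → D i + (κ′ (inject₁ i) + κ′ (suc i))) + (Dₗ + (κ′ l + κ′ zero))
                                                 ≡⟨ cong (_+ (Dₗ + (κ′ l + κ′ zero))) (∑-distrib-+ D (λ i → κ′ (inject₁ i) + κ′ (suc i))) ⟩
  sum D + sum (λ i → κ′ (inject₁ i) + κ′ (suc i)) + (Dₗ + (κ′ l + κ′ zero))
                                                 ≡⟨ cong (λ z → sum D + z + (Dₗ + (κ′ l + κ′ zero))) (∑-distrib-+ (κ′ ∘ inject₁) (κ′ ∘ suc)) ⟩
  sum D + (sum (κ′ ∘ inject₁) + sum (κ′ ∘ suc)) + (Dₗ + (κ′ l + κ′ zero))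
                                                 ≡⟨ rearrange (sum D) (sum (κ′ ∘ inject₁)) (sum (κ′ ∘ suc)) Dₗ (κ′ l) (κ′ zero) ⟩
  sum D + Dₗ + ((sum (κ′ ∘ inject₁) + κ′ l) + sum κ′)
                                                 ≡⟨ cong (λ z → sum D + Dₗ + (z + sum κ′)) (sum-init-last κ′) ⟨
  sum D + Dₗ + (sum κ′ + sum κ′)                 ≡⟨ cong (λ z → sum D + Dₗ + (sum κ′ + z)) (+-identityʳ (sum κ′)) ⟨
  sum D + Dₗ + 2 * sum κ′                        ≡⟨ cong (λ z → sum D + Dₗ + 2 * z) (sum-permute κ π) ⟨
  sum D + Dₗ + 2 * sum κ                         ∎
  where
  open ≤-Reasoning
  κ′ = κ ∘ (π ⟨$⟩ʳ_)
  l  = fromℕ (suc m)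
  D  = λ (i : Fin (suc m)) → d (π ⟨$⟩ʳ inject₁ i) (π ⟨$⟩ʳ suc i)
  Dₗ = d (π ⟨$⟩ʳ l) (π ⟨$⟩ʳ zero)
  inject₁≢suc : ∀ {k} (i : Fin k) → inject₁ i ≢ suc i
  inject₁≢suc i eq = 1+n≢n (trans (cong toℕ (sym eq)) (toℕ-inject₁ i))
  rearrange : ∀ a b c d e f → a + (b + c) + (d + (e + f)) ≡ a + d + ((b + e) + (f + c))
  rearrange = solve-∀
tourCost-lower {suc zero} d κ (s≤s ()) step π

-- `β` is the allowance of a step beyond length 1. The closing step is not of the form x, x + 1; it
-- is charged 2, whence the additional 1.
tourCost-upper : ∀ {N} (d : Fin N → Fin N → ℕ) (β : Fin N → ℕ) (π : Permutation′ N) →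
                 (∀ u v → d u v ≤ 2) →
                 (∀ x y → toℕ y ≡ suc (toℕ x) → d (π ⟨$⟩ʳ x) (π ⟨$⟩ʳ y) ≤ suc (β x)) →
                 tourCost d π ≤ suc (N + sum β)
tourCost-upper {zero}  d β π d≤2 step = z≤n
tourCost-upper {suc m} d β π d≤2 step = begin
  tourCost d π                                      ≤⟨ +-mono-≤ (sum-mono λ i → step (inject₁ i) (suc i) (cong suc (sym (toℕ-inject₁ i)))) (d≤2 _ _) ⟩
  sum (λ (i : Fin m) → 1 + β (inject₁ i)) + 2       ≡⟨ cong (_+ 2) (∑-distrib-+ (λ (_ : Fin m) → 1) (β ∘ inject₁)) ⟩
  sum {m} (λ _ → 1) + sum (β ∘ inject₁) + 2         ≤⟨ +-monoˡ-≤ 2 (+-mono-≤ (≤-reflexive (trans (sum-const m 1) (*-identityʳ m)))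
                                                          (≤-trans (m≤m+n _ _) (≤-reflexive (sym (sum-init-last β))))) ⟩
  m + sum β + 2                                     ≡⟨ +-comm (m + sum β) 2 ⟩
  suc (suc m + sum β)                               ∎
  where open ≤-Reasoning

-- Pigeonhole: a missed value could be punched out of the codomain, leaving an injection into a
-- smaller set.
injective⇒permutation : ∀ {n} (f : Fin n → Fin n) → (∀ {x y} → f x ≡ f y → x ≡ y) →
                        Σ[ π ∈ Permutation′ n ] (∀ x → π ⟨$⟩ʳ x ≡ f x)
injective⇒permutation {zero}  f inj = permutation f f (λ ()) (λ ()) , λ ()
injective⇒permutation {suc n} f inj =
  permutation f (proj₁ ∘ surj) (proj₂ ∘ surj) (λ x → inj (proj₂ (surj (f x)))) , λ _ → refl
  where
  surj : ∀ y → ∃[ x ] f x ≡ y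
  surj y with any? (λ x → f x ≟ y)
  ... | yes p = p
  ... | no ¬p = contradiction
    (injective⇒≤ {f = λ x → punchOut {i = y} (λ eq → ¬p (x , sym eq))}
                 (λ {x} {x′} eq → inj (punchOut-injective (λ e → ¬p (x , sym e)) (λ e → ¬p (x′ , sym e)) eq)))
    1+n≰n

-- Multiplicities in a list

occ : ∀ {n} → Fin n → List (Fin n) → ℕ
occ i []       = 0
occ i (x ∷ xs) = bit (does (i ≟ x)) + occ i xs

sum-indicator : ∀ {n} (x : Fin n) → sum (λ i → bit (does (i ≟ x))) ≡ 1
sum-indicator {suc n} zero    = cong suc (sum-0 n)
sum-indicator {suc n} (suc x) = sum-indicator x

sum-occ : ∀ {n} (xs : List (Fin n)) → sum (λ i → occ i xs) ≡ length xs
sum-occ {n} []  = sum-0 n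
sum-occ (x ∷ xs) = trans (∑-distrib-+ (λ i → bit (does (i ≟ x))) (λ i → occ i xs))
                         (cong₂ _+_ (sum-indicator x) (sum-occ xs))

occ≡0⇒∉ : ∀ {n} (i : Fin n) xs → occ i xs ≡ 0 → All (i ≢_) xs
occ≡0⇒∉ i []       eq = []
occ≡0⇒∉ i (x ∷ xs) eq with i ≟ x
... | no i≢x = i≢x ∷ occ≡0⇒∉ i xs eq

-- An edge with both ends free would extend the matching.
maximum-covers : ∀ {n} {E : BipartiteGraph n} {M} → IsMatching E M →
                 (∀ M′ → IsMatching E M′ → length M′ ≤ length M) →
                 ∀ i j → E i j ≡ true → 1 ≤ occ i (map proj₁ M) + occ j (map proj₂ M)
maximum-covers {M = M} isM maximal i j Eij
  with occ i (map proj₁ M) in eqˡ | occ j (map proj₂ M) in eqʳ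
... | suc _ | _     = s≤s z≤n
... | zero  | suc _ = s≤s z≤n
... | zero  | zero  = contradiction (maximal ((i , j) ∷ M) bigger) 1+n≰n
  where
  open IsMatching isM
  bigger : IsMatching _ ((i , j) ∷ M)
  bigger = record
    { edges   = Eij ∷ edges
    ; uniqueˡ = occ≡0⇒∉ i _ eqˡ ∷ uniqueˡ
    ; uniqueʳ = occ≡0⇒∉ j _ eqʳ ∷ uniqueʳ
    }

-- The blow-up: every vertex of the graph is replaced by h copies

index : ∀ n h → Fin (n * (h * 2)) → Fin n
index n h u = quotient (h * 2) u

copy : ∀ n h → Fin (n * (h * 2)) → Fin h
copy n h u = quotient 2 (remainder {n} (h * 2) u)

side : ∀ n h → Fin (n * (h * 2)) → Fin 2
side n h u = remainder {h} 2 (remainder {n} (h * 2) u)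

-- Mixed-radix numbering with the side as least significant digit. Consecutive points of a block
-- then alternate between the sides, and the RAM recovers index and side by one division by a
-- constant and one parity.
point : ∀ {n h} → Fin n → Fin h → Fin 2 → Fin (n * (h * 2))
point i c s = combine i (combine c s)

inSide : ∀ {n} → Fin 2 → Fin n → Fin (n + n)
inSide {n} zero       i = i ↑ˡ n
inSide {n} (suc zero) i = n ↑ʳ i

vertex : ∀ n h → Fin (n * (h * 2)) → Fin (n + n)
vertex n h u = inSide (side n h u) (index n h u)

module _ {n h : ℕ} where

  point-split : ∀ u → point (index n h u) (copy n h u) (side n h u) ≡ u
  point-split u = trans (cong (combine (index n h u)) (combine-remQuot {h} 2 (remainder {n} (h * 2) u)))
                        (combine-remQuot {n} (h * 2) u)

  index-point : ∀ (i : Fin n) (c : Fin h) s → index n h (point i c s) ≡ i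
  index-point i c s = cong proj₁ (remQuot-combine i (combine c s))

  copy-point : ∀ (i : Fin n) (c : Fin h) s → copy n h (point i c s) ≡ c
  copy-point i c s = trans (cong (quotient 2) (cong proj₂ (remQuot-combine i (combine c s))))
                           (cong proj₁ (remQuot-combine c s))

  side-point : ∀ (i : Fin n) (c : Fin h) s → side n h (point i c s) ≡ s
  side-point i c s = trans (cong (remainder {h} 2) (cong proj₂ (remQuot-combine i (combine c s))))
                           (cong proj₂ (remQuot-combine c s))

adjacency-sym : ∀ {n} (E : BipartiteGraph n) u v → adjacency E u v ≡ adjacency E v u
adjacency-sym {n} E u v with splitAt n u | splitAt n v
... | inj₁ _ | inj₁ _ = refl
... | inj₁ _ | inj₂ _ = refl
... | inj₂ _ | inj₁ _ = refl
... | inj₂ _ | inj₂ _ = refl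

adjacency-LR : ∀ {n} (E : BipartiteGraph n) i j → adjacency E (i ↑ˡ n) (n ↑ʳ j) ≡ E i j
adjacency-LR {n} E i j rewrite splitAt-↑ˡ n i n | splitAt-↑ʳ n n j = refl

adjacency-LL : ∀ {n} (E : BipartiteGraph n) i j → adjacency E (i ↑ˡ n) (j ↑ˡ n) ≡ false
adjacency-LL {n} E i j rewrite splitAt-↑ˡ n i n | splitAt-↑ˡ n j n = refl

adjacency-RR : ∀ {n} (E : BipartiteGraph n) i j → adjacency E (n ↑ʳ i) (n ↑ʳ j) ≡ false
adjacency-RR {n} E i j rewrite splitAt-↑ʳ n n i | splitAt-↑ʳ n n j = refl

2∸bit : ∀ b → 2 ∸ bit b ≡ 1 ⊎ 2 ∸ bit b ≡ 2
2∸bit false = inj₂ refl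
2∸bit true  = inj₁ refl

-- Two copies of the same vertex get distance 2, since no vertex is adjacent to itself; only equal
-- points have to be singled out.
blowup : ∀ {n} → BipartiteGraph n → (h : ℕ) → OneTwoTSP (n * (h * 2))
blowup {n} E h = record { d = dist ; d-ii = d-ii ; d-sym = d-sym ; d-12 = d-12 }
  where
  dist : Fin (n * (h * 2)) → Fin (n * (h * 2)) → ℕ
  dist u v = if does (u ≟ v) then 0 else 2 ∸ bit (adjacency E (vertex n h u) (vertex n h v))
  d-ii : ∀ u → dist u u ≡ 0
  d-ii u rewrite dec-true (u ≟ u) refl = refl
  d-sym : ∀ u v → dist u v ≡ dist v u
  d-sym u v with u ≟ v | v ≟ u
  ... | yes _ | yes _ = refl
  ... | yes p | no ¬p = contradiction (sym p) ¬p
  ... | no ¬p | yes p = contradiction (sym p) ¬p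
  ... | no _  | no _  = cong (λ b → 2 ∸ bit b) (adjacency-sym E (vertex n h u) (vertex n h v))
  d-12 : ∀ u v → u ≢ v → dist u v ≡ 1 ⊎ dist u v ≡ 2
  d-12 u v u≢v rewrite dec-false (u ≟ v) u≢v = 2∸bit (adjacency E (vertex n h u) (vertex n h v))

module _ {n} (E : BipartiteGraph n) (h : ℕ) where
  open OneTwoTSP (blowup E h)

  d≤2 : ∀ u v → d u v ≤ 2
  d≤2 u v with does (u ≟ v)
  ... | true  = z≤n
  ... | false = m∸n≤m 2 (bit (adjacency E (vertex n h u) (vertex n h v)))

  adjacent⇒d≤1 : ∀ u v → adjacency E (vertex n h u) (vertex n h v) ≡ true → d u v ≤ 1
  adjacent⇒d≤1 u v adj with does (u ≟ v)
  ... | true  = z≤n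
  ... | false rewrite adj = ≤-refl

  -- The endpoints of a maximum matching form a vertex cover, so every step of
  -- length 1 has an end above one of them.
  blowup-lower : ∀ {m} → 2 ≤ n * (h * 2) → IsMatchingNumber E m → ∀ π →
                 2 * (n * (h * 2)) ≤ tourCost d π + 4 * (h * m)
  blowup-lower 2≤N ((M , isM , refl) , maximal) π =
    subst (λ z → 2 * (n * (h * 2)) ≤ tourCost d π + z) total
          (tourCost-lower d (λ u → κ (side n h u) (index n h u)) 2≤N step π)
    where
    κ : Fin 2 → Fin n → ℕ
    κ zero       i = occ i (map proj₁ M)
    κ (suc zero) i = occ i (map proj₂ M)

    covered : ∀ s t i j → 2 ≤ 2 ∸ bit (adjacency E (inSide s i) (inSide t j)) + (κ s i + κ t j)
    covered zero zero i j rewrite adjacency-LL E i j = s≤s (s≤s z≤n)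
    covered (suc zero) (suc zero) i j rewrite adjacency-RR E i j = s≤s (s≤s z≤n)
    covered zero (suc zero) i j rewrite adjacency-LR E i j with E i j in eq
    ... | false = s≤s (s≤s z≤n)
    ... | true  = s≤s (maximum-covers isM maximal i j eq)
    covered (suc zero) zero i j
      rewrite adjacency-sym E (n ↑ʳ i) (j ↑ˡ n) | adjacency-LR E j i with E j i in eq
    ... | false = s≤s (s≤s z≤n)
    ... | true  = s≤s (subst (1 ≤_) (+-comm (κ zero j) (κ (suc zero) i)) (maximum-covers isM maximal j i eq))

    step : ∀ u v → u ≢ v → 2 ≤ d u v + (κ (side n h u) (index n h u) + κ (side n h v) (index n h v))
    step u v u≢v rewrite dec-false (u ≟ v) u≢v = covered (side n h u) (side n h v) (index n h u) (index n h v)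

    sum-copies : ∀ i → sum (λ j → κ (side n h (combine i j)) (index n h (combine i j)))
                       ≡ h * (κ zero i + κ (suc zero) i)
    sum-copies i = trans (sum-combine h (λ j → κ (side n h (combine i j)) (index n h (combine i j)))) (trans (sum-cong-≗ λ (c : Fin h) →
        cong₂ _+_ (cong₂ κ (side-point i c zero) (index-point i c zero))
                  (trans (+-identityʳ _) (cong₂ κ (side-point i c (suc zero)) (index-point i c (suc zero)))))
      (sum-const h _))

    sum-*ˡ : ∀ {k} c (f : Fin k → ℕ) → sum (λ i → c * f i) ≡ c * sum f
    sum-*ˡ {zero}  c f = sym (*-zeroʳ c)
    sum-*ˡ {suc k} c f = trans (cong (c * f zero +_) (sum-*ˡ c (f ∘ suc))) (sym (*-distribˡ-+ c (f zero) _))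

    total : 2 * sum (λ u → κ (side n h u) (index n h u)) ≡ 4 * (h * length M)
    total = begin
      2 * sum (λ u → κ (side n h u) (index n h u))    ≡⟨ cong (2 *_) (sum-combine n (λ u → κ (side n h u) (index n h u))) ⟩
      2 * sum (λ (i : Fin n) → sum (λ (j : Fin (h * 2)) → κ (side n h (combine i j)) (index n h (combine i j))))
                                                      ≡⟨ cong (2 *_) (sum-cong-≗ {n} sum-copies) ⟩
      2 * sum (λ i → h * (κ zero i + κ (suc zero) i)) ≡⟨ cong (2 *_) (sum-*ˡ h (λ i → κ zero i + κ (suc zero) i)) ⟩
      2 * (h * sum (λ i → κ zero i + κ (suc zero) i)) ≡⟨ cong (λ z → 2 * (h * z)) (∑-distrib-+ (κ zero) (κ (suc zero))) ⟩
      2 * (h * (sum (κ zero) + sum (κ (suc zero))))   ≡⟨ cong₂ (λ a b → 2 * (h * (a + b)))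
                                                           (trans (sum-occ (map proj₁ M)) (length-map proj₁ M))
                                                           (trans (sum-occ (map proj₂ M)) (length-map proj₂ M)) ⟩
      2 * (h * (length M + length M))                 ≡⟨ regroup h (length M) ⟩
      4 * (h * length M)                              ∎
      where
      open ≡-Reasoning
      regroup : ∀ h m → 2 * (h * (m + m)) ≡ 4 * (h * m)
      regroup = solve-∀

-- Short tours from perfect matchings

lookup-unique : ∀ {A B : Set} (f : A → B) (xs : List A) → Unique (map f xs) →
                ∀ i j → f (lookup xs i) ≡ f (lookup xs j) → i ≡ j
lookup-unique f (x ∷ xs) (x∉ ∷ u) zero    zero    eq = refl
lookup-unique f (x ∷ xs) (x∉ ∷ u) zero    (suc j) eq =
  contradiction eq (All.lookup x∉ (∈-map⁺ f (∈-lookup j)))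
lookup-unique f (x ∷ xs) (x∉ ∷ u) (suc i) zero    eq =
  contradiction (sym eq) (All.lookup x∉ (∈-map⁺ f (∈-lookup i)))
lookup-unique f (x ∷ xs) (x∉ ∷ u) (suc i) (suc j) eq = cong suc (lookup-unique f xs u i j eq)

-- The n edges have n distinct left ends and n distinct right ends, so each projection of the list
-- of edges is a permutation. Indexing both by the side lets the tour treat the sides uniformly.
perfect⇒permutations : ∀ {n} {E : BipartiteGraph n} → HasPerfect E →
                       Σ[ σ ∈ (Fin 2 → Permutation′ n) ]
                         (∀ i → E (σ zero ⟨$⟩ʳ i) (σ (suc zero) ⟨$⟩ʳ i) ≡ true)
perfect⇒permutations {n} {E} ((M , isM , len) , _) =
  (λ { zero → proj₁ πˡ ; (suc zero) → proj₁ πʳ }) ,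
  λ i → trans (cong₂ E (proj₂ πˡ i) (proj₂ πʳ i)) (All.lookup edges (∈-lookup (at i)))
  where
  open IsMatching isM
  at : Fin n → Fin (length M)
  at = cast (sym len)
  at-injective : ∀ {x y} → at x ≡ at y → x ≡ y
  at-injective {x} {y} eq = toℕ-injective
    (trans (sym (toℕ-cast (sym len) x)) (trans (cong toℕ eq) (toℕ-cast (sym len) y)))
  πˡ = injective⇒permutation (λ i → proj₁ (lookup M (at i)))
         (at-injective ∘ lookup-unique proj₁ M uniqueˡ _ _)
  πʳ = injective⇒permutation (λ i → proj₂ (lookup M (at i)))
         (at-injective ∘ lookup-unique proj₂ M uniqueʳ _ _)

-- No carry occurs while the low digit is not maximal, and mixed-radix representations are unique.
combine-suc : ∀ {n k} (i i′ : Fin n) (j j′ : Fin k) →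
              toℕ (combine i′ j′) ≡ suc (toℕ (combine i j)) → suc (toℕ j) < k →
              i′ ≡ i × toℕ j′ ≡ suc (toℕ j)
combine-suc {n} {k} i i′ j j′ eq j<k =
  proj₁ same , trans (cong toℕ (proj₂ same)) (toℕ-fromℕ< j<k)
  where
  open ≡-Reasoning
  same : i′ ≡ i × j′ ≡ fromℕ< j<k
  same = combine-injective i′ j′ i (fromℕ< j<k) (toℕ-injective (begin
    toℕ (combine i′ j′)              ≡⟨ eq ⟩
    suc (toℕ (combine i j))          ≡⟨ cong suc (toℕ-combine i j) ⟩
    suc (k * toℕ i + toℕ j)          ≡⟨ +-suc (k * toℕ i) (toℕ j) ⟨
    k * toℕ i + suc (toℕ j)          ≡⟨ cong (k * toℕ i +_) (toℕ-fromℕ< j<k) ⟨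
    k * toℕ i + toℕ (fromℕ< j<k)     ≡⟨ toℕ-combine i (fromℕ< j<k) ⟨
    toℕ (combine i (fromℕ< j<k))     ∎))

-- With equal low bits the hypothesis would read 2c′ = 2c + 1.
combine-parity : ∀ {h} (c c′ : Fin h) (s s′ : Fin 2) →
                 toℕ (combine c′ s′) ≡ suc (toℕ (combine c s)) → s′ ≢ s
combine-parity c c′ s .s eq refl = even≢odd (toℕ c′) (toℕ c)
  (+-cancelʳ-≡ (toℕ s) (2 * toℕ c′) (suc (2 * toℕ c))
    (trans (sym (toℕ-combine c′ s)) (trans eq (cong suc (toℕ-combine c s)))))

module _ {n} (E : BipartiteGraph n) (h : ℕ) where
  open OneTwoTSP (blowup E h)

  -- Block i of the tour alternates between the copies of the two ends of the
  -- i-th edge of the perfect matching, so only the steps between blocks can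
  -- have length 2.
  blowup-upper : HasPerfect E → ∃[ π ] tourCost d π ≤ suc (n * (h * 2) + n)
  blowup-upper perfect = π , ≤-trans (tourCost-upper d β π (d≤2 E h) step)
                                     (s≤s (+-monoʳ-≤ (n * (h * 2)) sum-β))
    where
    σ = proj₁ (perfect⇒permutations perfect)
    σ-edge = proj₂ (perfect⇒permutations perfect)

    -- The relabelling of the index depends only on the side, which is itself preserved; hence it is
    -- inverted side by side.
    via : (Fin 2 → Fin n → Fin n) → Fin (n * (h * 2)) → Fin (n * (h * 2))
    via f u = point (f (side n h u) (index n h u)) (copy n h u) (side n h u)

    via-inverse : ∀ f g → (∀ s i → f s (g s i) ≡ i) → ∀ u → via f (via g u) ≡ u
    via-inverse f g fg u
      rewrite index-point (g (side n h u) (index n h u)) (copy n h u) (side n h u)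
            | copy-point (g (side n h u) (index n h u)) (copy n h u) (side n h u)
            | side-point (g (side n h u) (index n h u)) (copy n h u) (side n h u)
            | fg (side n h u) (index n h u) = point-split {n} {h} u

    forth back : Fin 2 → Fin n → Fin n
    forth s i = σ s ⟨$⟩ʳ i
    back s i = σ s ⟨$⟩ˡ i

    π : Permutation′ (n * (h * 2))
    π = permutation (via forth) (via back)
          (via-inverse forth back (λ s i → inverseʳ (σ s)))
          (via-inverse back forth (λ s i → inverseˡ (σ s)))

    vertex-π : ∀ u → vertex n h (π ⟨$⟩ʳ u) ≡ inSide (side n h u) (forth (side n h u) (index n h u))
    vertex-π u = cong₂ inSide (side-point (forth (side n h u) (index n h u)) (copy n h u) (side n h u))
                              (index-point (forth (side n h u) (index n h u)) (copy n h u) (side n h u))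

    alternate : ∀ s s′ i → s′ ≢ s →
                adjacency E (inSide s (forth s i)) (inSide s′ (forth s′ i)) ≡ true
    alternate zero       zero       i ne = contradiction refl ne
    alternate (suc zero) (suc zero) i ne = contradiction refl ne
    alternate zero       (suc zero) i ne = trans (adjacency-LR E _ _) (σ-edge i)
    alternate (suc zero) zero       i ne =
      trans (adjacency-sym E (n ↑ʳ _) (_ ↑ˡ n)) (trans (adjacency-LR E _ _) (σ-edge i))

    lastOfBlock : ∀ {k} → Fin k → ℕ
    lastOfBlock {k} j = bit (suc (toℕ j) ≡ᵇ k)

    β : Fin (n * (h * 2)) → ℕ
    β u = lastOfBlock (remainder {n} (h * 2) u)

    step : ∀ x y → toℕ y ≡ suc (toℕ x) → d (π ⟨$⟩ʳ x) (π ⟨$⟩ʳ y) ≤ suc (β x)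
    step x y eq with suc (toℕ (remainder {n} (h * 2) x)) ≡ᵇ h * 2
                   in isLast
    ... | true  = d≤2 E h (π ⟨$⟩ʳ x) (π ⟨$⟩ʳ y)
    ... | false = adjacent⇒d≤1 E h (π ⟨$⟩ʳ x) (π ⟨$⟩ʳ y) (trans
        (cong₂ (adjacency E) (vertex-π x) (trans (vertex-π y)
          (cong (λ i → inSide (side n h y) (forth (side n h y) i)) (proj₁ next))))
        (alternate (side n h x) (side n h y) (index n h x)
          (combine-parity (copy n h x) (copy n h y) (side n h x) (side n h y)
            (trans (cong toℕ (combine-remQuot {h} 2 _))
              (trans (proj₂ next) (cong (suc ∘ toℕ) (sym (combine-remQuot {h} 2 _))))))))
      where
      next : index n h y ≡ index n h x ×
             toℕ (remainder {n} (h * 2) y) ≡ suc (toℕ (remainder {n} (h * 2) x))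
      next = combine-suc _ _ _ _
        (trans (cong toℕ (combine-remQuot {n} (h * 2) y))
          (trans eq (cong (suc ∘ toℕ) (sym (combine-remQuot {n} (h * 2) x)))))
        (≤∧≢⇒< (toℕ<n _) λ full → subst Bool.T isLast (≡⇒≡ᵇ _ _ full))

    sum-lastOfBlock : ∀ k → sum (lastOfBlock {k}) ≤ 1
    sum-lastOfBlock zero          = z≤n
    sum-lastOfBlock (suc zero)    = ≤-refl
    sum-lastOfBlock (suc (suc k)) = sum-lastOfBlock (suc k)

    sum-β : sum β ≤ n
    sum-β = begin
      sum β                                     ≡⟨ sum-combine n β ⟩
      sum (λ (i : Fin n) → sum (λ (j : Fin (h * 2)) → β (combine i j)))
        ≡⟨ sum-cong-≗ (λ (i : Fin n) → sum-cong-≗ λ j → cong (lastOfBlock ∘ proj₂) (remQuot-combine {n} {h * 2} i j)) ⟩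
      sum {n} (λ _ → sum (lastOfBlock {h * 2})) ≤⟨ sum-mono {n} (λ _ → sum-lastOfBlock (h * 2)) ⟩
      sum {n} (λ _ → 1)                         ≡⟨ sum-const n 1 ⟩
      n * 1                                     ≡⟨ *-identityʳ n ⟩
      n                                         ∎
      where open ≤-Reasoning

-- Registers 8, 9, … hold those of the simulated program; register 0 holds n.
locate : ℕ → Reg → Reg → Cmd
locate K y t =
  const 3 2 ⨾ arith div 4 (8 + y) 3 ⨾ arith mul 4 4 3 ⨾ arith sub 4 (8 + y) 4 ⨾
  arith mul 4 4 0 ⨾ const 3 K ⨾ arith div 3 (8 + y) 3 ⨾ arith add t 3 4

-- div e e is 0 if e = 0, and 1 otherwise.
measure : Reg → Reg → Reg → Cmd
measure x y z =
  query 5 1 2 ⨾ const 3 2 ⨾ arith sub 5 3 5 ⨾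
  arith sub 3 (8 + y) (8 + z) ⨾ arith sub 4 (8 + z) (8 + y) ⨾ arith add 3 3 4 ⨾
  arith div 3 3 3 ⨾ arith mul (8 + x) 5 3

distance : ℕ → Reg → Reg → Reg → Cmd
distance K x y z = locate K y 1 ⨾ locate K z 2 ⨾ measure x y z

compile : ℕ → Cmd → Cmd
compile K skip            = skip
compile K (const x k)     = const (8 + x) k
compile K (arith o x y z) = arith o (8 + x) (8 + y) (8 + z)
compile K (load x y)      = load (8 + x) (8 + y)
compile K (store x y)     = store (8 + x) (8 + y)
compile K (flip x)        = flip (8 + x)
compile K (query x y z)   = distance K x y z
compile K (P ⨾ Q)         = compile K P ⨾ compile K Q
compile K (ifnz x P Q)    = ifnz (8 + x) (compile K P) (compile K Q)
compile K (while x P)     = while (8 + x) (compile K P)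

-- Justifies the arithmetic of `locate`: if u = 2hi + 2c + s for h copies, dividing by 2h yields i,
-- and the parity of u is s because 2h is even. The right side starts at address n.
vertexAddress : ∀ n h (u : Fin (n * (suc h * 2))) →
                toℕ (vertex n (suc h) u) ≡ toℕ u ℕ./ (suc h * 2) + (toℕ u ∸ toℕ u ℕ./ 2 * 2) * n
vertexAddress n h u = trans (toℕ-inSide (side n (suc h) u) (index n (suc h) u))
    (sym (cong₂ (λ a b → a + b * n) block parity))
  where
  i = index n (suc h) u
  ρ = remainder {n} (suc h * 2) u
  c = copy n (suc h) u
  s = side n (suc h) u

  toℕ-inSide : ∀ {n} (s : Fin 2) (i : Fin n) → toℕ (inSide s i) ≡ toℕ i + toℕ s * n
  toℕ-inSide zero       i = trans (toℕ-↑ˡ i _) (sym (+-identityʳ (toℕ i)))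
  toℕ-inSide {n} (suc zero) i = trans (toℕ-↑ʳ n i)
    (trans (+-comm n (toℕ i)) (cong (toℕ i +_) (sym (+-identityʳ n))))

  u≡ : toℕ u ≡ (suc h * 2) * toℕ i + toℕ ρ
  u≡ = trans (cong toℕ (sym (combine-remQuot {n} (suc h * 2) u))) (toℕ-combine i ρ)

  ρ≡ : toℕ ρ ≡ 2 * toℕ c + toℕ s
  ρ≡ = trans (cong toℕ (sym (combine-remQuot {suc h} 2 ρ))) (toℕ-combine c s)

  block : toℕ u ℕ./ (suc h * 2) ≡ toℕ i
  block = begin
    toℕ u ℕ./ (suc h * 2)                                        ≡⟨ cong (ℕ._/ (suc h * 2)) u≡ ⟩
    ((suc h * 2) * toℕ i + toℕ ρ) ℕ./ (suc h * 2)                ≡⟨ +-distrib-/-∣ˡ (toℕ ρ) (m∣m*n (toℕ i)) ⟩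
    (suc h * 2) * toℕ i ℕ./ (suc h * 2) + toℕ ρ ℕ./ (suc h * 2)    ≡⟨ cong₂ _+_ (trans (cong (ℕ._/ (suc h * 2)) (*-comm (suc h * 2) (toℕ i))) (m*n/n≡m (toℕ i) (suc h * 2)))
                                                                            (m<n⇒m/n≡0 (toℕ<n ρ)) ⟩
    toℕ i + 0                                                  ≡⟨ +-identityʳ (toℕ i) ⟩
    toℕ i                                                      ∎
    where open ≡-Reasoning

  parity : toℕ u ∸ toℕ u ℕ./ 2 * 2 ≡ toℕ s
  parity = begin
    toℕ u ∸ toℕ u ℕ./ 2 * 2                                ≡⟨ m%n≡m∸m/n*n (toℕ u) 2 ⟨
    toℕ u % 2                                            ≡⟨ cong (_% 2) (trans u≡ (trans (cong ((suc h * 2) * toℕ i +_) ρ≡) (regroup (suc h) (toℕ i) (toℕ c) (toℕ s)))) ⟩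
    (toℕ s + (suc h * toℕ i + toℕ c) * 2) % 2            ≡⟨ [m+kn]%n≡m%n (toℕ s) (suc h * toℕ i + toℕ c) 2 ⟩
    toℕ s % 2                                            ≡⟨ m<n⇒m%n≡m (toℕ<n s) ⟩
    toℕ s                                                ∎
    where
    open ≡-Reasoning
    regroup : ∀ h i c s → (h * 2) * i + (2 * c + s) ≡ s + (h * i + c) * 2
    regroup = solve-∀

-- Register updates and bounds on register contents

div-self : ∀ e → e ≢ 0 → ⟦ div ⟧ e e ≡ 1
div-self zero    e≢0 = contradiction refl e≢0
div-self (suc e) e≢0 = trans (cong (ℕ._/ suc e) (sym (*-identityˡ (suc e)))) (m*n/n≡m 1 (suc e))

div-self≤1 : ∀ e → ⟦ div ⟧ e e ≤ 1
div-self≤1 zero    = z≤n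
div-self≤1 (suc e) = ≤-reflexive (div-self (suc e) 1+n≢0)

≡ᵇ-refl : ∀ x → (x ≡ᵇ x) ≡ true
≡ᵇ-refl zero    = refl
≡ᵇ-refl (suc x) = ≡ᵇ-refl x

update-same : ∀ f x v → (f [ x ↦ v ]) x ≡ v
update-same f x v = cong (λ b → if b then v else f x) (≡ᵇ-refl x)

update-other : ∀ f x v {y} → (x ≡ᵇ y) ≡ false → (f [ x ↦ v ]) y ≡ f y
update-other f x v {y} x≢y = cong (λ b → if b then v else f y) x≢y

update-cong : ∀ {f g : ℕ → ℕ} x {v w} → (∀ y → f y ≡ g y) → v ≡ w →
              ∀ y → (f [ x ↦ v ]) y ≡ (g [ x ↦ w ]) y
update-cong x f≗g v≡w y with x ≡ᵇ y
... | true  = v≡w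
... | false = f≗g y

update-≤ : ∀ {f : ℕ → ℕ} {B} x {v} → (∀ y → f y ≤ B) → v ≤ B → ∀ y → (f [ x ↦ v ]) y ≤ B
update-≤ x f≤B v≤B y with x ≡ᵇ y
... | true  = v≤B
... | false = f≤B y

record Bounded (B : ℕ) (s : State) : Set where
  constructor bounded
  field
    regs≤ : ∀ x → regs s x ≤ B
    mem≤  : ∀ a → mem s a ≤ B

-- Each value written is a constant or result below W, a coin, an oracle answer or a copy. This is
-- what controls the output registers of the estimator, whose products are formed in the final
-- comparison.
Run-bounded : ∀ {m} {O : Oracle m} {W B} → W ≤ B → 1 ≤ B → (∀ i j → O i j ≤ B) →
              ∀ {P s s′ t} → Run O W P s s′ t → Bounded B s → Bounded B s′
Run-bounded {O = O} {B = B} W≤B 1≤B O≤B = go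
  where
  bit≤ : ∀ b → bit b ≤ B
  bit≤ true  = 1≤B
  bit≤ false = z≤n
  go : ∀ {P s s′ t} → Run O _ P s s′ t → Bounded B s → Bounded B s′
  go run-skip                            b             = b
  go (run-const {x = x} k<W)             (bounded r h) = bounded (update-≤ x r (≤-trans (<⇒≤ k<W) W≤B)) h
  go (run-arith {x = x} v<W)             (bounded r h) = bounded (update-≤ x r (≤-trans (<⇒≤ v<W) W≤B)) h
  go (run-load {x = x})                  (bounded r h) = bounded (update-≤ x r (h _)) h
  go (run-store {x = x} {y} {r = f})     (bounded r h) = bounded r (update-≤ (f x) h (r y))
  go (run-flip {x = x} {b = c})          (bounded r h) = bounded (update-≤ x r (bit≤ c)) h
  go (run-query {x = x} i j _ _)         (bounded r h) = bounded (update-≤ x r (O≤B i j)) h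
  go (run-seq p q)                       b             = go q (go p b)
  go (run-then _ p)                      b             = go p b
  go (run-else _ p)                      b             = go p b
  go (run-loop _ p q)                    b             = go q (go p b)
  go (run-done _)                        b             = b

-- Running the estimator on the blow-up

module Simulation {n : ℕ} (E : BipartiteGraph n) (h′ : ℕ) {W W′ : ℕ}
  (W≤W′ : W ≤ W′) (2<W′ : 2 < W′) (K<W′ : suc h′ * 2 < W′)
  (2N≤W′ : n * (suc h′ * 2) + n * (suc h′ * 2) ≤ W′) (ω₂ : List Bool) where

  h K N : ℕ
  h = suc h′
  K = h * 2
  N = n * K
  open OneTwoTSP (blowup E h)

  O′ : Oracle (n + n)
  O′ u v = bit (adjacency E u v)

  -- Register 0 must keep n for the address computations and the final comparison. The memories
  -- agree exactly because all scratch values live in registers below 8.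
  record Simulates (s s′ : State) : Set where
    constructor simulates
    field
      regs≡  : ∀ x → regs s′ (8 + x) ≡ regs s x
      size≡  : regs s′ 0 ≡ n
      mem≡   : ∀ a → mem s′ a ≡ mem s a
      coins≡ : coins s′ ≡ coins s List.++ ω₂

  N≤W′ : N ≤ W′
  N≤W′ = ≤-trans (m≤m+n N N) 2N≤W′

  n+n≤N : n + n ≤ N
  n+n≤N = begin
    n + n             ≡⟨ cong (n +_) (+-identityʳ n) ⟨
    2 * n             ≡⟨ *-comm 2 n ⟩
    n * 2             ≤⟨ *-monoʳ-≤ n (s≤s (s≤s z≤n)) ⟩
    n * K             ∎
    where open ≤-Reasoning

  -- The frame condition uses Boolean inequalities so that `refl` proves it for the fixed registers
  -- and for every simulated register 8 + x at once.
  locate-run : ∀ (u : Fin N) y t {r m ω} → r (8 + y) ≡ toℕ u → r 0 ≡ n →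
               ∃[ r′ ] Run O′ W′ (locate K y t) ⟨ r , m , ω ⟩ ⟨ r′ , m , ω ⟩ 8
                       × r′ t ≡ toℕ (vertex n h u)
                       × (∀ x → (3 ≡ᵇ x) ≡ false → (4 ≡ᵇ x) ≡ false → (t ≡ᵇ x) ≡ false → r′ x ≡ r x)
  locate-run u y t {r} r≡u r≡n =
    _ ,
    run-seq (run-const 2<W′) (run-seq (run-arith (below (m/n≤m a 2)))
    (run-seq (run-arith (below (m/n*n≤m a 2))) (run-seq (run-arith (below (m∸n≤m a (a ℕ./ 2 * 2))))
    (run-seq (run-arith (≤-<-trans (m≤n+m _ (a ℕ./ K)) address<W′)) (run-seq (run-const K<W′)
    (run-seq (run-arith (below (m/n≤m a K))) (run-arith address<W′))))))) ,
    same , other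
    where
    a = r (8 + y)
    address : a ℕ./ K + (a ∸ a ℕ./ 2 * 2) * r 0 ≡ toℕ (vertex n h u)
    address = trans (cong₂ (λ a n → a ℕ./ K + (a ∸ a ℕ./ 2 * 2) * n) r≡u r≡n) (sym (vertexAddress n h′ u))
    r₁ = r [ 3 ↦ 2 ]
    r₂ = r₁ [ 4 ↦ a ℕ./ 2 ]
    r₃ = r₂ [ 4 ↦ a ℕ./ 2 * 2 ]
    r₄ = r₃ [ 4 ↦ a ∸ a ℕ./ 2 * 2 ]
    r₅ = r₄ [ 4 ↦ (a ∸ a ℕ./ 2 * 2) * r 0 ]
    r₆ = r₅ [ 3 ↦ K ]
    r₇ = r₆ [ 3 ↦ a ℕ./ K ]
    v = a ℕ./ K + (a ∸ a ℕ./ 2 * 2) * r 0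
    same : (r₇ [ t ↦ v ]) t ≡ toℕ (vertex n h u)
    same = trans (update-same r₇ t v) address
    other : ∀ x → (3 ≡ᵇ x) ≡ false → (4 ≡ᵇ x) ≡ false → (t ≡ᵇ x) ≡ false →
            (r₇ [ t ↦ v ]) x ≡ r x
    other x x≢3 x≢4 x≢t =
      trans (update-other r₇ t v {x} x≢t) (trans (update-other r₆ 3 (a ℕ./ K) {x} x≢3)
      (trans (update-other r₅ 3 K {x} x≢3) (trans (update-other r₄ 4 ((a ∸ a ℕ./ 2 * 2) * r 0) {x} x≢4)
      (trans (update-other r₃ 4 (a ∸ a ℕ./ 2 * 2) {x} x≢4) (trans (update-other r₂ 4 (a ℕ./ 2 * 2) {x} x≢4)
      (trans (update-other r₁ 4 (a ℕ./ 2) {x} x≢4) (update-other r 3 2 {x} x≢3)))))))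
    below : ∀ {b} → b ≤ a → b < W′
    below b≤a = <-≤-trans (≤-<-trans b≤a (subst (_< N) (sym r≡u) (toℕ<n u))) N≤W′
    address<W′ : a ℕ./ K + (a ∸ a ℕ./ 2 * 2) * r 0 < W′
    address<W′ = subst (_< W′) (sym address)
      (<-≤-trans (toℕ<n (vertex n h u)) (≤-trans n+n≤N N≤W′))

  -- Here e = |u - v|, so e div e indicates u ≠ v. It clears the 2 that the missing loop in the
  -- graph would produce on equal points.
  distance-value : ∀ (u v : Fin N) →
    let e = (toℕ u ∸ toℕ v) + (toℕ v ∸ toℕ u) in
    (2 ∸ bit (adjacency E (vertex n h u) (vertex n h v))) * ⟦ div ⟧ e e ≡ d u v
  distance-value u v with u ≟ v
  ... | yes refl rewrite n∸n≡0 (toℕ u) = *-zeroʳ (2 ∸ bit (adjacency E (vertex n h u) (vertex n h u)))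
  ... | no u≢v   = trans (cong ((2 ∸ bit (adjacency E (vertex n h u) (vertex n h v))) *_) (div-self _ apart)) (*-identityʳ _)
    where
    apart : (toℕ u ∸ toℕ v) + (toℕ v ∸ toℕ u) ≢ 0
    apart eq = u≢v (toℕ-injective (≤-antisym (m∸n≡0⇒m≤n (m+n≡0⇒m≡0 _ eq)) (m∸n≡0⇒m≤n (m+n≡0⇒n≡0 (toℕ u ∸ toℕ v) eq))))

  -- A query costs 24 steps, 8 for each of the two addresses and 8 for the distance. The same factor
  -- leaves room for the single extra step of a branch or loop test.
  suc≤ : ∀ {t′ t} → t′ ≤ t * 24 → suc t′ ≤ suc t * 24
  suc≤ t′≤ = +-mono-≤ (s≤s (z≤n {23})) t′≤

  -- Only the last instruction writes register 8 + x, so x may coincide with y or z.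
  measure-run : ∀ x y z {r m ω} (u v : Fin N) → toℕ (vertex n h u) ≡ r 1 → toℕ (vertex n h v) ≡ r 2 →
                r (8 + y) ≡ toℕ u → r (8 + z) ≡ toℕ v →
                ∃[ w ] Run O′ W′ (measure x y z) ⟨ r , m , ω ⟩ ⟨ w [ 8 + x ↦ d u v ] , m , ω ⟩ 8
                       × (∀ i → w (8 + i) ≡ r (8 + i)) × w 0 ≡ r 0
  measure-run x y z {r} {m} {ω} u v 1≡ 2≡ ru rv =
    _ , subst (λ e → Run O′ W′ (measure x y z) ⟨ r , m , ω ⟩ ⟨ w [ 8 + x ↦ e ] , m , ω ⟩ 8) value
    (run-seq (run-query (vertex n h u) (vertex n h v) 1≡ 2≡)
    (run-seq (run-const 2<W′)
    (run-seq (run-arith (≤-<-trans (m∸n≤m 2 (bit (adjacency E (vertex n h u) (vertex n h v)))) 2<W′))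
    (run-seq (run-arith (≤-<-trans (m∸n≤m a b) (<-≤-trans a<N N≤W′)))
    (run-seq (run-arith (≤-<-trans (m∸n≤m b a) (<-≤-trans b<N N≤W′)))
    (run-seq (run-arith (<-≤-trans (+-mono-< (≤-<-trans (m∸n≤m a b) a<N) (≤-<-trans (m∸n≤m b a) b<N)) 2N≤W′))
    (run-seq (run-arith (≤-<-trans (div-self≤1 e) (<-trans (s≤s (s≤s z≤n)) 2<W′)))
    (run-arith (≤-<-trans (≤-trans (≤-reflexive value) (d≤2 E h u v)) 2<W′))))))))) ,
    (λ i → refl) , refl
    where
    a = r (8 + y)
    b = r (8 + z)
    e = (a ∸ b) + (b ∸ a)
    D = 2 ∸ bit (adjacency E (vertex n h u) (vertex n h v))
    w = ((((((r [ 5 ↦ bit (adjacency E (vertex n h u) (vertex n h v)) ]) [ 3 ↦ 2 ]) [ 5 ↦ D ])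
        [ 3 ↦ a ∸ b ]) [ 4 ↦ b ∸ a ]) [ 3 ↦ e ]) [ 3 ↦ ⟦ div ⟧ e e ]
    a<N : a < N
    a<N = subst (_< N) (sym ru) (toℕ<n u)
    b<N : b < N
    b<N = subst (_< N) (sym rv) (toℕ<n v)
    value : D * ⟦ div ⟧ e e ≡ d u v
    value = trans (cong₂ (λ a b → D * ⟦ div ⟧ ((a ∸ b) + (b ∸ a)) ((a ∸ b) + (b ∸ a))) ru rv)
                  (distance-value u v)

  distance-run : ∀ x y z {s s′} (u v : Fin N) → toℕ u ≡ regs s y → toℕ v ≡ regs s z → Simulates s s′ →
                 ∃[ r ] Run O′ W′ (distance K x y z) s′ ⟨ r , mem s′ , coins s′ ⟩ 24
                        × (∀ w → r (8 + w) ≡ (regs s [ x ↦ d u v ]) w) × r 0 ≡ n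
  distance-run x y z {s} {⟨ r , m , ω ⟩} u v u≡ v≡ (simulates regs≡ size≡ _ _) =
    first (locate-run u y 1 ru size≡)
    where
    ru = trans (regs≡ y) (sym u≡)
    rv = trans (regs≡ z) (sym v≡)
    Goal = ∃[ r′ ] Run O′ W′ (distance K x y z) ⟨ r , m , ω ⟩ ⟨ r′ , m , ω ⟩ 24
                   × (∀ w → r′ (8 + w) ≡ (regs s [ x ↦ d u v ]) w) × r′ 0 ≡ n
    Kept : ℕ → (ℕ → ℕ) → (ℕ → ℕ) → Set
    Kept t f f′ = ∀ x → (3 ≡ᵇ x) ≡ false → (4 ≡ᵇ x) ≡ false → (t ≡ᵇ x) ≡ false → f′ x ≡ f x
    third : ∀ {r₁ r₂} → Run O′ W′ (locate K y 1) ⟨ r , m , ω ⟩ ⟨ r₁ , m , ω ⟩ 8 → Kept 1 r r₁ →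
            Run O′ W′ (locate K z 2) ⟨ r₁ , m , ω ⟩ ⟨ r₂ , m , ω ⟩ 8 → Kept 2 r₁ r₂ →
            ∃[ w ] Run O′ W′ (measure x y z) ⟨ r₂ , m , ω ⟩ ⟨ w [ 8 + x ↦ d u v ] , m , ω ⟩ 8
                   × (∀ i → w (8 + i) ≡ r₂ (8 + i)) × w 0 ≡ r₂ 0 → Goal
    third run₁ k₁ run₂ k₂ (w , run₃ , wx , w0) =
      w [ 8 + x ↦ d u v ] , run-seq run₁ (run-seq run₂ run₃) ,
      update-cong x (λ i → trans (wx i) (trans (k₂ (8 + i) refl refl refl)
                                        (trans (k₁ (8 + i) refl refl refl) (regs≡ i)))) refl ,
      trans w0 (trans (k₂ 0 refl refl refl) (trans (k₁ 0 refl refl refl) size≡))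
    second : ∀ {r₁} → Run O′ W′ (locate K y 1) ⟨ r , m , ω ⟩ ⟨ r₁ , m , ω ⟩ 8 →
             r₁ 1 ≡ toℕ (vertex n h u) → Kept 1 r r₁ →
             ∃[ r₂ ] Run O′ W′ (locate K z 2) ⟨ r₁ , m , ω ⟩ ⟨ r₂ , m , ω ⟩ 8
                     × r₂ 2 ≡ toℕ (vertex n h v) × Kept 2 r₁ r₂ → Goal
    second run₁ at₁ k₁ (r₂ , run₂ , at₂ , k₂) =
      third run₁ k₁ run₂ k₂ (measure-run x y z u v
        (sym (trans (k₂ 1 refl refl refl) at₁)) (sym at₂)
        (trans (k₂ (8 + y) refl refl refl) (trans (k₁ (8 + y) refl refl refl) ru))
        (trans (k₂ (8 + z) refl refl refl) (trans (k₁ (8 + z) refl refl refl) rv)))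
    first : ∃[ r₁ ] Run O′ W′ (locate K y 1) ⟨ r , m , ω ⟩ ⟨ r₁ , m , ω ⟩ 8
                    × r₁ 1 ≡ toℕ (vertex n h u) × Kept 1 r r₁ → Goal
    first (r₁ , run₁ , at₁ , k₁) =
      second run₁ at₁ k₁ (locate-run v z 2 (trans (k₁ (8 + z) refl refl refl) rv)
                                           (trans (k₁ 0 refl refl refl) size≡))

  simulate : ∀ {P s s₁ t s′} → Run d W P s s₁ t → Simulates s s′ →
             ∃[ s₁′ ] ∃[ t′ ] Run O′ W′ (compile K P) s′ s₁′ t′ × Simulates s₁ s₁′ × t′ ≤ t * 24
  simulate run-skip S = _ , _ , run-skip , S , s≤s z≤n
  simulate (run-const {x = x} k<W) (simulates r≡ n≡ m≡ c≡) =
    _ , _ , run-const (<-≤-trans k<W W≤W′) , simulates (update-cong x r≡ refl) n≡ m≡ c≡ , s≤s z≤n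
  simulate (run-arith {o = o} {x} {y} {z} v<W) (simulates r≡ n≡ m≡ c≡) =
    _ , _ , run-arith (<-≤-trans (subst (_< W) (sym v≡) v<W) W≤W′) ,
    simulates (update-cong x r≡ v≡) n≡ m≡ c≡ , s≤s z≤n
    where v≡ = cong₂ ⟦ o ⟧ (r≡ y) (r≡ z)
  simulate (run-load {x = x} {y} {h = m}) (simulates r≡ n≡ m≡ c≡) =
    _ , _ , run-load , simulates (update-cong x r≡ (trans (m≡ _) (cong m (r≡ y)))) n≡ m≡ c≡ , s≤s z≤n
  simulate {s′ = s′} (run-store {x = x} {y} {r = r} {h = m}) (simulates r≡ n≡ m≡ c≡) =
    _ , _ , run-store ,
    simulates r≡ n≡ (λ a → trans (cong (λ b → (mem s′ [ b ↦ regs s′ (8 + y) ]) a) (r≡ x))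
                                 (update-cong (r x) m≡ (r≡ y) a)) c≡ , s≤s z≤n
  simulate {s′ = ⟨ _ , _ , _ ⟩} (run-flip {x = x}) (simulates r≡ n≡ m≡ refl) =
    _ , _ , run-flip , simulates (update-cong x r≡ refl) n≡ m≡ refl , s≤s z≤n
  simulate (run-query {x = x} {y} {z} i j i≡ j≡) S@(simulates r≡ n≡ m≡ c≡)
    = let r , run , r≡′ , n≡′ = distance-run x y z i j i≡ j≡ S in _ , _ , run , simulates r≡′ n≡′ m≡ c≡ , ≤-refl
  simulate (run-seq {t = t} {u} p q) S
    = let _ , _ , p′ , S₁ , t≤ = simulate p S
          _ , _ , q′ , S₂ , u≤ = simulate q S₁
      in _ , _ , run-seq p′ q′ , S₂ , ≤-trans (+-mono-≤ t≤ u≤) (≤-reflexive (sym (*-distribʳ-+ 24 t u)))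
  simulate (run-then {x = x} {t = t} x≢0 p) S
    = let _ , _ , p′ , S₁ , t≤ = simulate p S
      in _ , _ , run-then (x≢0 ∘ trans (sym (Simulates.regs≡ S x))) p′ , S₁ , suc≤ {t = t} t≤
  simulate (run-else {x = x} {t = t} x≡0 p) S
    = let _ , _ , p′ , S₁ , t≤ = simulate p S
      in _ , _ , run-else (trans (Simulates.regs≡ S x) x≡0) p′ , S₁ , suc≤ {t = t} t≤
  simulate (run-loop {x = x} {t = t} {u} x≢0 p q) S
    = let _ , _ , p′ , S₁ , t≤ = simulate p S
          _ , _ , q′ , S₂ , u≤ = simulate q S₁
      in _ , _ , run-loop (x≢0 ∘ trans (sym (Simulates.regs≡ S x))) p′ q′ , S₂ ,
      suc≤ {t = t + u} (≤-trans (+-mono-≤ t≤ u≤) (≤-reflexive (sym (*-distribʳ-+ 24 t u))))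
  simulate (run-done {x = x} x≡0) S =
    _ , _ , run-done (trans (Simulates.regs≡ S x) x≡0) , S , s≤s z≤n

-- Nonnegative fractions

-- `_/_` reduces to lowest terms and so hides its arguments; unnormalised fractions recover them and
-- turn comparisons into cross-multiplication.
toℚᵘ-/ : ∀ a m → toℚᵘ (a / suc m) ℚᵘ.≃ mkℚᵘ a m
toℚᵘ-/ a m = ℚ.toℚᵘ-fromℚᵘ (mkℚᵘ a m)

/≤/⇒*≤* : ∀ {a m c n} → ℤ.+ a / suc m ℚ.≤ ℤ.+ c / suc n → a * suc n ≤ c * suc m
/≤/⇒*≤* {a} {m} {c} {n} le with *≤* le′ ← ℚᵘ.≤-respˡ-≃ (toℚᵘ-/ (ℤ.+ a) m) (ℚᵘ.≤-respʳ-≃ (toℚᵘ-/ (ℤ.+ c) n) (ℚ.toℚᵘ-mono-≤ le)) =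
  ℤ.drop‿+≤+ (subst₂ ℤ._≤_ (sym (ℤ.pos-* a (suc n))) (sym (ℤ.pos-* c (suc m))) le′)

*≤*⇒/≤/ : ∀ {a m c n} → a * suc n ≤ c * suc m → ℤ.+ a / suc m ℚ.≤ ℤ.+ c / suc n
*≤*⇒/≤/ {a} {m} {c} {n} le =
  ℚ.toℚᵘ-cancel-≤ (ℚᵘ.≤-respˡ-≃ (ℚᵘ.≃-sym (toℚᵘ-/ (ℤ.+ a) m)) (ℚᵘ.≤-respʳ-≃ (ℚᵘ.≃-sym (toℚᵘ-/ (ℤ.+ c) n))
    (*≤* (subst₂ ℤ._≤_ (ℤ.pos-* a (suc n)) (ℤ.pos-* c (suc m)) (ℤ.+≤+ le)))))

/≡/⇒*≡* : ∀ {a m c n} → ℤ.+ a / suc m ≡ ℤ.+ c / suc n → a * suc n ≡ c * suc m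
/≡/⇒*≡* {a} {m} {c} {n} eq =
  ≤-antisym (/≤/⇒*≤* {a} {m} {c} {n} (ℚ.≤-reflexive eq)) (/≤/⇒*≤* {c} {n} {a} {m} (ℚ.≤-reflexive (sym eq)))

*≡*⇒/≡/ : ∀ {a m c n} → a * suc n ≡ c * suc m → ℤ.+ a / suc m ≡ ℤ.+ c / suc n
*≡*⇒/≡/ {a} {m} {c} {n} eq =
  ℚ.≤-antisym (*≤*⇒/≤/ {a} {m} {c} {n} (≤-reflexive eq)) (*≤*⇒/≤/ {c} {n} {a} {m} (≤-reflexive (sym eq)))

/-*-/ : ∀ a m c n → (ℤ.+ a / suc m) ℚ.* (ℤ.+ c / suc n) ≡ ℤ.+ (a * c) / (suc m * suc n)
/-*-/ a m c n = ℚ.toℚᵘ-injective (ℚᵘ.≃-trans (ℚ.toℚᵘ-homo-* (ℤ.+ a / suc m) (ℤ.+ c / suc n))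
  (ℚᵘ.≃-trans (ℚᵘ.*-cong (toℚᵘ-/ (ℤ.+ a) m) (toℚᵘ-/ (ℤ.+ c) n))
    (ℚᵘ.≃-trans (ℚᵘ.≃-reflexive (cong (λ z → mkℚᵘ z (n + m * suc n)) (sym (ℤ.pos-* a c))))
      (ℚᵘ.≃-sym (toℚᵘ-/ (ℤ.+ (a * c)) (n + m * suc n))))))

/-+-/ : ∀ a m c n → (ℤ.+ a / suc m) ℚ.+ (ℤ.+ c / suc n) ≡ ℤ.+ (a * suc n + c * suc m) / (suc m * suc n)
/-+-/ a m c n = ℚ.toℚᵘ-injective (ℚᵘ.≃-trans (ℚ.toℚᵘ-homo-+ (ℤ.+ a / suc m) (ℤ.+ c / suc n))
  (ℚᵘ.≃-trans (ℚᵘ.+-cong (toℚᵘ-/ (ℤ.+ a) m) (toℚᵘ-/ (ℤ.+ c) n))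
    (ℚᵘ.≃-trans (ℚᵘ.≃-reflexive (cong (λ z → mkℚᵘ z (n + m * suc n))
        (cong₂ ℤ._+_ (sym (ℤ.pos-* a (suc n))) (sym (ℤ.pos-* c (suc m))))))
      (ℚᵘ.≃-sym (toℚᵘ-/ (ℤ.+ (a * suc n + c * suc m)) (n + m * suc n))))))

fromNat-nonNeg : ∀ n → ℚ.NonNegative (fromNat n)
fromNat-nonNeg n = ℚ.normalize-nonNeg n 1

fromNat-* : ∀ m n → fromNat (m * n) ≡ fromNat m ℚ.* fromNat n
fromNat-* m n = sym (/-*-/ m 0 n 0)

-- A positive numerator is at least 1. Adding 1 to the denominator makes it at least 2; taken as b,
-- it gives 1/2b ≤ 1/4 < 1/2.
1/⟨1+denominator⟩≤ : ∀ (p : ℚ) → 0ℚ ℚ.< p → ℤ.+ 1 / suc (suc (ℚ.denominator-1 p)) ℚ.≤ p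
1/⟨1+denominator⟩≤ (mkℚ (ℤ.+ zero) d _)    (*<* (ℤ.+<+ ()))
1/⟨1+denominator⟩≤ p@(mkℚ (ℤ.+ suc a) d _) _ =
  ℚ.toℚᵘ-cancel-≤ (ℚᵘ.≤-respˡ-≃ (ℚᵘ.≃-sym (toℚᵘ-/ (ℤ.+ 1) (suc d)))
    (*≤* (ℤ.+≤+ (≤-trans (≤-reflexive (+-identityʳ (suc d)))
      (≤-trans (n≤1+n (suc d)) (m≤m+n (suc (suc d)) (a * suc (suc d))))))))
1/⟨1+denominator⟩≤ (mkℚ ℤ.-[1+ a ] d _)    (*<* ())

-- Extending the coin sequence

words : ∀ n → List (Vec Bool n)
words zero    = [] ∷ []
words (suc n) = cartesianProductWith _∷_ (true ∷ false ∷ []) (words n)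

words-unique : ∀ n → Unique (words n)
words-unique zero    = [] ∷ []
words-unique (suc n) = Unique.cartesianProductWith⁺ _∷_ Vec.∷-injective
  (((λ ()) ∷ []) ∷ [] ∷ []) (words-unique n)

length-cartesianProductWith : ∀ {A B C : Set} (f : A → B → C) xs ys →
                              length (cartesianProductWith f xs ys) ≡ length xs * length ys
length-cartesianProductWith f []       ys = refl
length-cartesianProductWith f (x ∷ xs) ys =
  trans (length-++ (map (f x) ys)) (cong₂ _+_ (length-map (f x) ys) (length-cartesianProductWith f xs ys))

length-words : ∀ n → length (words n) ≡ 2 ^ n
length-words zero    = refl
length-words (suc n) = trans (length-cartesianProductWith _∷_ (true ∷ false ∷ []) (words n)) (cong (2 *_) (length-words n))

-- Every good sequence has 2 ^ e extensions, so the good sequences and the sample space grow by the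
-- same factor.
ProbAtLeast-++ : ∀ {p t e} {A : Vec Bool t → Set} {B : Vec Bool (t + e) → Set} →
                 (∀ ω ω′ → A ω → B (ω ++ ω′)) → ProbAtLeast p t A → ProbAtLeast p (t + e) B
ProbAtLeast-++ {p} {t} {e} {A} {B} A⇒B (S , S! , AS , p≤) =
  cartesianProductWith _++_ S (words e) ,
  Unique.cartesianProductWith⁺ _++_ (Vec.++-injective _ _) S! (words-unique e) ,
  All.cartesianProductWith⁺ (setoid _) (setoid _) _++_ S (words e) (λ {ω} {ω′} ω∈S _ → A⇒B ω ω′ (All.lookup AS ω∈S)) ,
  (begin
    p ℚ.* fromNat (2 ^ (t + e))                       ≡⟨ cong (λ z → p ℚ.* fromNat z) (^-distribˡ-+-* 2 t e) ⟩
    p ℚ.* fromNat (2 ^ t * 2 ^ e)                     ≡⟨ cong (p ℚ.*_) (fromNat-* (2 ^ t) (2 ^ e)) ⟩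
    p ℚ.* (fromNat (2 ^ t) ℚ.* fromNat (2 ^ e))       ≡⟨ ℚ.*-assoc p _ _ ⟨
    (p ℚ.* fromNat (2 ^ t)) ℚ.* fromNat (2 ^ e)       ≤⟨ ℚ.*-monoʳ-≤-nonNeg (fromNat (2 ^ e)) {{fromNat-nonNeg (2 ^ e)}} p≤ ⟩
    fromNat (length S) ℚ.* fromNat (2 ^ e)            ≡⟨ fromNat-* (length S) (2 ^ e) ⟨
    fromNat (length S * 2 ^ e)                        ≡⟨ cong (λ z → fromNat (length S * z)) (length-words e) ⟨
    fromNat (length S * length (words e))             ≡⟨ cong fromNat (length-cartesianProductWith _++_ S (words e)) ⟨
    fromNat (length (cartesianProductWith _++_ S (words e))) ∎)
  where open ℚ.≤-Reasoning

-- Growth rates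

-- Allows growth bounds to be proved for squares, where the hypothesis at exponent 2k leaves a
-- factor n to spare.
*-cancel-square-≤ : ∀ {a b} → a * a ≤ b * b → a ≤ b
*-cancel-square-≤ a²≤b² = ≮⇒≥ λ b<a → <⇒≱ (*-mono-< b<a b<a) a²≤b²

^-distribʳ-* : ∀ k a b → (a * b) ^ k ≡ a ^ k * b ^ k
^-distribʳ-* zero    a b = refl
^-distribʳ-* (suc k) a b = trans (cong ((a * b) *_) (^-distribʳ-* k a b)) ([m*n]*[o*p]≡[m*o]*[n*p] a b (a ^ k) (b ^ k))

^-double : ∀ a k → a ^ (k + k) ≡ a ^ k * a ^ k
^-double a k = ^-distribˡ-+-* a k k

-- The spare factor n in n²⁽ᵏ⁺¹⁾ against n²ᵏ⁺¹ absorbs the constants.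
almostLinear-rescale : ∀ {T T′ : ℕ → ℕ} c K .{{_ : NonZero K}} →
                       (∀ n → T′ n ≤ c * (T (n * K) ⊔ 1)) → AlmostLinear T → AlmostLinear T′
almostLinear-rescale {T} {T′} c K T′≤ time k 1≤k
  with n₀ , T≤ ← time (k + k) (≤-trans 1≤k (m≤m+n k k)) =
  suc (n₀ ⊔ D) , λ n n₁≤n → *-cancel-square-≤ (begin
    T′ n ^ k * T′ n ^ k                      ≡⟨ ^-double (T′ n) k ⟨
    T′ n ^ (k + k)                           ≤⟨ ^-monoˡ-≤ (k + k) (T′≤ n) ⟩
    (c * (T (n * K) ⊔ 1)) ^ (k + k)          ≡⟨ ^-distribʳ-* (k + k) c _ ⟩
    c ^ (k + k) * (T (n * K) ⊔ 1) ^ (k + k)  ≤⟨ *-monoʳ-≤ (c ^ (k + k)) (⊔1-bound n (T (n * K)) (≤-trans (s≤s z≤n) n₁≤n)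
                                                  (T≤ (n * K) (≤-trans (≤-trans (≤-trans (m≤m⊔n n₀ D) (n≤1+n _)) n₁≤n) (m≤m*n n K)))) ⟩
    c ^ (k + k) * (n * K) ^ suc (k + k)      ≡⟨ cong (c ^ (k + k) *_) (trans (^-distribʳ-* (suc (k + k)) n K) (*-comm (n ^ suc (k + k)) _)) ⟩
    c ^ (k + k) * (K ^ suc (k + k) * n ^ suc (k + k)) ≡⟨ *-assoc (c ^ (k + k)) _ _ ⟨
    D * n ^ suc (k + k)                      ≤⟨ *-monoˡ-≤ (n ^ suc (k + k)) (≤-trans (≤-trans (m≤n⊔m n₀ D) (n≤1+n _)) n₁≤n) ⟩
    n * n ^ suc (k + k)                      ≡⟨ cong (n ^_) (cong suc (+-suc k k)) ⟨
    n ^ (suc k + suc k)                      ≡⟨ ^-double n (suc k) ⟩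
    n ^ suc k * n ^ suc k                    ∎)
  where
  open ≤-Reasoning
  D = c ^ (k + k) * K ^ suc (k + k)
  ⊔1-bound : ∀ n t → 1 ≤ n → t ^ (k + k) ≤ (n * K) ^ suc (k + k) → (t ⊔ 1) ^ (k + k) ≤ (n * K) ^ suc (k + k)
  ⊔1-bound n zero    1≤n _  = ≤-trans (≤-reflexive (^-zeroˡ (k + k)))
    (≤-trans (≤-reflexive (sym (^-zeroˡ (suc (k + k))))) (^-monoˡ-≤ (suc (k + k)) (≤-trans 1≤n (m≤m*n n K))))
  ⊔1-bound n (suc t) 1≤n le rewrite ⊔-identityʳ t = le

-- The base is that of the word size. It is at least 2 even for n = 0, so raising the exponent
-- absorbs every constant.
PolyBounded : (ℕ → ℕ) → Set
PolyBounded f = ∃[ c ] ∀ n → f n < (n + 2) ^ c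

2≤n+2 : ∀ n → 2 ≤ n + 2
2≤n+2 n = m≤n+m 2 n

poly-const : ∀ k → PolyBounded (λ _ → k)
poly-const k = k , λ n → <-≤-trans (k<2^k k) (^-monoˡ-≤ k (2≤n+2 n))
  where
  k<2^k : ∀ k → k < 2 ^ k
  k<2^k zero    = s≤s z≤n
  k<2^k (suc k) = ≤-trans (+-mono-≤ (≤-trans (s≤s z≤n) (k<2^k k)) (k<2^k k))
                          (≤-reflexive (cong (λ z → 2 ^ k + z) (sym (+-identityʳ (2 ^ k)))))

poly-id : PolyBounded (λ n → n)
poly-id = 1 , λ n → ≤-trans (m<m+n n {2} (s≤s z≤n)) (≤-reflexive (sym (*-identityʳ (n + 2))))

poly-* : ∀ {f g} → PolyBounded f → PolyBounded g → PolyBounded (λ n → f n * g n)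
poly-* (a , f<) (b , g<) = a + b , λ n →
  <-≤-trans (*-mono-< (f< n) (g< n)) (≤-reflexive (sym (^-distribˡ-+-* (n + 2) a b)))

poly-+ : ∀ {f g} → PolyBounded f → PolyBounded g → PolyBounded (λ n → f n + g n)
poly-+ {f} {g} (a , f<) (b , g<) = suc (a + b) , λ n →
  let X = n + 2
      X≢0 = >-nonZero (≤-trans (s≤s z≤n) (2≤n+2 n)) in begin-strict
    f n + g n                   <⟨ +-mono-< (f< n) (g< n) ⟩
    X ^ a + X ^ b               ≤⟨ +-mono-≤ (^-monoʳ-≤ X {{X≢0}} (m≤m+n a b)) (^-monoʳ-≤ X {{X≢0}} (m≤n+m b a)) ⟩
    X ^ (a + b) + X ^ (a + b)   ≡⟨ cong (λ z → X ^ (a + b) + z) (+-identityʳ _) ⟨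
    2 * X ^ (a + b)             ≤⟨ *-monoˡ-≤ (X ^ (a + b)) (2≤n+2 n) ⟩
    X ^ suc (a + b)             ∎
  where open ≤-Reasoning

poly-^ : ∀ {f} c → PolyBounded f → PolyBounded (λ n → f n ^ c)
poly-^ zero    pf = poly-const 1
poly-^ (suc c) pf = poly-* pf (poly-^ c pf)

-- The reduction program and its word size

prepare : ℕ → Cmd
prepare K = const 1 K ⨾ arith mul 8 0 1

-- Register 0 becomes 1 if a · out₀ < c · n · out₁, and 0 otherwise.
decide : ℕ → ℕ → Cmd
decide a c =
  const 1 a ⨾ arith mul 1 1 8 ⨾ const 2 c ⨾ arith mul 2 2 0 ⨾ arith mul 2 2 9 ⨾
  arith sub 3 2 1 ⨾ arith div 0 3 3

reduction : (K a c : ℕ) → Cmd → Cmd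
reduction K a c P = prepare K ⨾ compile K P ⨾ decide a c

verdict : (a c n : ℕ) → (ℕ → ℕ) → ℕ
verdict a c n out = ⟦ div ⟧ (c * n * out 1 ∸ a * out 0) (c * n * out 1 ∸ a * out 0)

module _ {n : ℕ} (E : BipartiteGraph n) (h′ a c : ℕ) {W W′ : ℕ} where
  private
    K N B : ℕ
    K = suc h′ * 2
    N = n * K
    -- Dominates results below W, the size N and distances up to 2. Being positive, it also gives c
    -- n ≤ c n B.
    B = suc (W + N + 2)

  -- One summand per kind of value: those of the estimator, the constants 2 and K, the sum in
  -- `measure`, and the two products and two constants of `decide`.
  space : ℕ
  space = W + (2 + (K + ((N + N) + (a * B + (c * n) * B + (a + c)))))

  module _ (fits : space < W′) (ω₂ : List Bool) where
    private
      below : ∀ {x} → x ≤ space → x < W′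
      below x≤ = ≤-<-trans x≤ fits
      2≤ : 2 ≤ space
      2≤ = ≤-trans (m≤m+n 2 _) (m≤n+m _ W)
      after2 : K + ((N + N) + (a * B + (c * n) * B + (a + c))) ≤ space
      after2 = ≤-trans (m≤n+m _ 2) (m≤n+m _ W)
      afterK : (N + N) + (a * B + (c * n) * B + (a + c)) ≤ space
      afterK = ≤-trans (m≤n+m _ K) after2
      after2N : a * B + (c * n) * B + (a + c) ≤ space
      after2N = ≤-trans (m≤n+m _ (N + N)) afterK
      W≤W′ : W ≤ W′
      W≤W′ = <⇒≤ (below (m≤m+n W _))
      2N≤W′ : N + N ≤ W′
      2N≤W′ = <⇒≤ (below (≤-trans (m≤m+n (N + N) _) afterK))
      aB≤ : a * B ≤ space
      aB≤ = ≤-trans (m≤m+n (a * B) _) (≤-trans (m≤m+n _ (a + c)) after2N)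
      cnB≤ : (c * n) * B ≤ space
      cnB≤ = ≤-trans (m≤n+m _ (a * B)) (≤-trans (m≤m+n _ (a + c)) after2N)
      a+c≤ : a + c ≤ space
      a+c≤ = ≤-trans (m≤n+m _ (a * B + (c * n) * B)) after2N

    open Simulation E h′ W≤W′ (below 2≤) (below (≤-trans (m≤m+n K _) after2)) 2N≤W′ ω₂
      using (O′; Simulates; simulates; simulate)
    open OneTwoTSP (blowup E (suc h′)) using (d)

    decide-run : ∀ {r m ω} → r 0 ≡ n → r 8 ≤ B → r 9 ≤ B →
                 ∃[ s ] Run O′ W′ (decide a c) ⟨ r , m , ω ⟩ s 7
                        × regs s 0 ≡ verdict a c n (λ x → r (8 + x))
    decide-run {r} n≡ r8≤ r9≤ =
      _ ,
      run-seq (run-const (below (≤-trans (m≤m+n a c) a+c≤)))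
      (run-seq (run-arith (below a*r8≤))
      (run-seq (run-const (below (≤-trans (m≤n+m c a) a+c≤)))
      (run-seq (run-arith (below (≤-trans (≤-reflexive (cong (c *_) n≡)) (≤-trans (m≤m*n (c * n) B) cnB≤))))
      (run-seq (run-arith (below e≤))
      (run-seq (run-arith (below (≤-trans (m∸n≤m (c * r 0 * r 9) (a * r 8)) e≤)))
      (run-arith (below (≤-trans (div-self≤1 (c * r 0 * r 9 ∸ a * r 8)) (≤-trans (s≤s z≤n) 2≤))))))))) ,
      cong (λ z → ⟦ div ⟧ (c * z * r 9 ∸ a * r 8) (c * z * r 9 ∸ a * r 8)) n≡
      where
      a*r8≤ : a * r 8 ≤ space
      a*r8≤ = ≤-trans (*-monoʳ-≤ a r8≤) aB≤
      e≤ : c * r 0 * r 9 ≤ space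
      e≤ = ≤-trans (≤-trans (≤-reflexive (cong (λ z → c * z * r 9) n≡)) (*-monoʳ-≤ (c * n) r9≤)) cnB≤

    reduction-run : ∀ {P ω s t} → Run d W P (init N ω) s t →
                    ∃[ s′ ] ∃[ t′ ] Run O′ W′ (reduction K a c P) (init n (ω List.++ ω₂)) s′ t′
                                    × t′ ≤ t * 24 + 9 × regs s′ 0 ≡ verdict a c n (regs s)
    reduction-run {P} {ω} {s} {t} run = assemble (simulate run start)
      where
      r₀ : ℕ → ℕ
      r₀ = (((λ _ → 0) [ 0 ↦ n ]) [ 1 ↦ K ]) [ 8 ↦ N ]
      start : Simulates (init N ω) ⟨ r₀ , (λ _ → 0) , ω List.++ ω₂ ⟩
      -- Simulated register 0 is register 8 and holds N; the K left in register 1 lies outside the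
      -- simulated range.
      start = simulates (λ { zero → refl ; (suc x) → refl }) refl (λ _ → refl) refl
      N≤B : N ≤ B
      N≤B = ≤-trans (≤-trans (m≤n+m N W) (m≤m+n (W + N) 2)) (n≤1+n _)
      final : Bounded B s
      final = Run-bounded (≤-trans (≤-trans (m≤m+n W N) (m≤m+n (W + N) 2)) (n≤1+n _)) (s≤s z≤n)
                (λ i j → ≤-trans (d≤2 E (suc h′) i j) (≤-trans (m≤n+m 2 (W + N)) (n≤1+n _))) run
                (bounded (λ { zero → N≤B ; (suc x) → z≤n }) (λ _ → z≤n))
      assemble : ∃[ s₁ ] ∃[ t₁ ] Run O′ W′ (compile K P) ⟨ r₀ , (λ _ → 0) , ω List.++ ω₂ ⟩ s₁ t₁
                                 × Simulates s s₁ × t₁ ≤ t * 24 → _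
      assemble (s₁ , t₁ , run₁ , simulates regs≡ n≡ _ _ , t₁≤) = conclude
        (decide-run n≡ (≤-trans (≤-reflexive (regs≡ 0)) (Bounded.regs≤ final 0))
                       (≤-trans (≤-reflexive (regs≡ 1)) (Bounded.regs≤ final 1)))
        where
        conclude : ∃[ s₂ ] Run O′ W′ (decide a c) s₁ s₂ 7
                           × regs s₂ 0 ≡ verdict a c n (λ x → regs s₁ (8 + x)) →
                   ∃[ s′ ] ∃[ t′ ] Run O′ W′ (reduction K a c P) (init n (ω List.++ ω₂)) s′ t′
                                   × t′ ≤ t * 24 + 9 × regs s′ 0 ≡ verdict a c n (regs s)
        conclude (s₂ , run₂ , out≡) =
          s₂ , 2 + (t₁ + 7) ,
          run-seq (run-seq (run-const (below (≤-trans (m≤m+n K _) after2)))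
                           (run-arith (below (≤-trans (≤-trans (m≤m+n N N) (m≤m+n (N + N) _)) afterK))))
                  (run-seq run₁ run₂) ,
          ≤-trans (≤-reflexive (trans (+-comm 2 (t₁ + 7)) (+-assoc t₁ 7 2))) (+-monoˡ-≤ 9 t₁≤) ,
          trans out≡ (cong₂ (λ x y → ⟦ div ⟧ (c * n * y ∸ a * x) (c * n * y ∸ a * x)) (regs≡ 0) (regs≡ 1))

-- Choice of the constants and separation of the two cases

module Gap (ε₀ : ℚ) (0<ε₀ : 0ℚ ℚ.< ε₀) where

  -- With b = 2 + δ, which satisfies 1 / b ≤ ε₀, these are ε = 1 / 2b,
  -- b₂ = 2b, ρ = 3b − 2 and the number h = 3b of copies; h′ = h − 1 = 3b − 1
  -- also is the numerator of the threshold (3b − 1) N / 2b.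
  δ h′ K b₂ ρ : ℕ
  δ  = ℚ.denominator-1 ε₀
  h′ = 5 + 3 * δ
  K  = suc h′ * 2
  b₂ = 4 + (δ + δ)
  ρ  = 4 + 3 * δ

  ε : ℚ
  ε = ℤ.+ 1 / b₂

  -- (3b - 2) / 2b = 3/2 - 1/b, and 1/b ≤ ε₀.
  ratio≤ : ℤ.+ 3 / 2 ℚ.- ε₀ ℚ.≤ ℤ.+ ρ / b₂
  ratio≤ = begin
    ℤ.+ 3 / 2 ℚ.- ε₀                                     ≡⟨ cong (ℚ._- ε₀) three-halves ⟩
    (ℤ.+ ρ / b₂ ℚ.+ ℤ.+ 1 / (2 + δ)) ℚ.- ε₀                ≤⟨ ℚ.+-monoˡ-≤ (ℚ.- ε₀) (ℚ.+-monoʳ-≤ (ℤ.+ ρ / b₂) (1/⟨1+denominator⟩≤ ε₀ 0<ε₀)) ⟩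
    (ℤ.+ ρ / b₂ ℚ.+ ε₀) ℚ.- ε₀                           ≡⟨ ℚ.+-assoc (ℤ.+ ρ / b₂) ε₀ (ℚ.- ε₀) ⟩
    ℤ.+ ρ / b₂ ℚ.+ (ε₀ ℚ.- ε₀)                           ≡⟨ cong (λ z → ℤ.+ ρ / b₂ ℚ.+ z) (ℚ.+-inverseʳ ε₀) ⟩
    ℤ.+ ρ / b₂ ℚ.+ 0ℚ                                    ≡⟨ ℚ.+-identityʳ (ℤ.+ ρ / b₂) ⟩
    ℤ.+ ρ / b₂                                           ∎
    where
    open ℚ.≤-Reasoning
    clear : ∀ δ → 3 * ((4 + (δ + δ)) * (2 + δ)) ≡ ((4 + 3 * δ) * (2 + δ) + 1 * (4 + (δ + δ))) * 2
    clear = solve-∀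
    three-halves : ℤ.+ 3 / 2 ≡ ℤ.+ ρ / b₂ ℚ.+ ℤ.+ 1 / (2 + δ)
    three-halves = trans (*≡*⇒/≡/ {3} {1} {ρ * (2 + δ) + 1 * b₂} {1 + δ + (3 + (δ + δ)) * (2 + δ)} (clear δ))
                         (sym (/-+-/ ρ (3 + (δ + δ)) 1 (1 + δ)))

  0<ε : 0ℚ ℚ.< ε
  0<ε = ℚ.positive⁻¹ ε {{ℚ.normalize-pos 1 b₂}}

  ε<½ : ε ℚ.< ½
  ε<½ = ℚ.≰⇒> λ ½≤ε → contradiction (/≤/⇒*≤* {1} {1} {1} {3 + (δ + δ)} ½≤ε) λ { (s≤s (s≤s ())) }

  record Estimate (τ out₀ out₁ : ℕ) : Set where
    field
      out₁≥1 : 1 ≤ out₁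
      lower  : τ * out₁ ≤ out₀
      upper  : b₂ * out₀ ≤ ρ * τ * out₁

  estimate : ∀ {τ out₀ out₁} (nz : NonZero out₁) →
             fromNat τ ℚ.≤ _/_ (ℤ.+ out₀) out₁ {{nz}} →
             _/_ (ℤ.+ out₀) out₁ {{nz}} ℚ.≤ (ℤ.+ 3 / 2 ℚ.- ε₀) ℚ.* fromNat τ → Estimate τ out₀ out₁
  estimate {τ} {out₀} {suc q} nz τ≤ ≤τ = record
    { out₁≥1 = s≤s z≤n
    ; lower  = ≤-trans (/≤/⇒*≤* {τ} {0} {out₀} {q} τ≤) (≤-reflexive (*-identityʳ out₀))
    ; upper  = ≤-trans (≤-reflexive (trans (*-comm b₂ out₀) (cong (out₀ *_) (sym (*-identityʳ b₂)))))
                 (/≤/⇒*≤* {out₀} {q} {ρ * τ} {(3 + (δ + δ)) * 1} (ℚ.≤-trans ≤τ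
                   (ℚ.≤-trans (ℚ.*-monoʳ-≤-nonNeg (fromNat τ) {{fromNat-nonNeg τ}} ratio≤)
                              (ℚ.≤-reflexive (/-*-/ ρ (3 + (δ + δ)) τ 0)))))
    }

  -- (1/2 + 1/b₂) / 2 = (2 + b₂) / 4b₂, with denominators cleared.
  small-size : ∀ {n m} → fromNat m ≡ (½ ℚ.+ ε) ℚ.* (ℤ.+ n / 2) → 4 * b₂ * m ≡ (2 + b₂) * n
  small-size {n} {m} eq = trans (*-comm (4 * b₂) m) (trans (cong (m *_) (twice b₂))
    (trans (/≡/⇒*≡* {m} {0} {(1 * b₂ + 1 * 2) * n} {1 + (3 + (δ + δ) + 1 * b₂) * 2} (trans eq
        (trans (cong (ℚ._* (ℤ.+ n / 2)) (/-+-/ 1 1 1 (3 + (δ + δ)))) (/-*-/ (1 * b₂ + 1 * 2) (3 + (δ + δ) + 1 * b₂) n 1))))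
      (collect b₂ n)))
    where
    twice : ∀ b → 4 * b ≡ 2 * b * 2
    twice = solve-∀
    collect : ∀ b n → (1 * b + 1 * 2) * n * 1 ≡ (2 + b) * n
    collect = solve-∀

  module _ {n : ℕ} (E : BipartiteGraph n) where
    private
      N : ℕ
      N = n * K

    open OneTwoTSP (blowup E (suc h′)) using (d)

    verdict-perfect : ∀ {τ out} → 1 ≤ n → HasPerfect E → IsOptimalCost (blowup E (suc h′)) τ →
                      Estimate τ (out 0) (out 1) → verdict b₂ (h′ * K) n out ≡ 1
    verdict-perfect {τ} {out} 1≤n perfect (_ , optimal) est = div-self _ (m>n⇒m∸n≢0 gap)
      where
      open Estimate est
      open ≤-Reasoning
      tour = blowup-upper E (suc h′) perfect
      -- The tour costs at most N + n + 1; rounding 1 up to n makes the bound homogeneous in n.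
      τ≤ : τ ≤ N + (n + n)
      τ≤ = ≤-trans (optimal (proj₁ tour)) (≤-trans (proj₂ tour)
        (≤-trans (≤-reflexive (sym (+-suc N n))) (+-monoʳ-≤ N (+-monoˡ-≤ n 1≤n))))
      -- With N = 6bn, the difference (3b - 1) N - (3b - 2)(N + 2n) is N - (6b - 4) n = 4n, which is
      -- positive.
      slack : ∀ δ n → (4 + 3 * δ) * (n * ((6 + 3 * δ) * 2) + (n + n)) + 4 * n ≡ (5 + 3 * δ) * ((6 + 3 * δ) * 2) * n
      slack = solve-∀
      gap : b₂ * out 0 < h′ * K * n * out 1
      gap = begin-strict
        b₂ * out 0                             ≤⟨ upper ⟩
        ρ * τ * out 1                          ≤⟨ *-monoˡ-≤ (out 1) (*-monoʳ-≤ ρ τ≤) ⟩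
        ρ * (N + (n + n)) * out 1              <⟨ *-monoˡ-< (out 1) {{>-nonZero out₁≥1}} (m<m+n (ρ * (N + (n + n))) {4 * n} (≤-trans 1≤n (m≤n*m n 4))) ⟩
        (ρ * (N + (n + n)) + 4 * n) * out 1    ≡⟨ cong (_* out 1) (slack δ n) ⟩
        h′ * K * n * out 1                     ∎

    verdict-small : ∀ {τ out} → 1 ≤ n → HasSmall ε E → IsOptimalCost (blowup E (suc h′)) τ →
                    Estimate τ (out 0) (out 1) → verdict b₂ (h′ * K) n out ≡ 0
    verdict-small {τ} {out} 1≤n (m , isμ , size) ((π , cost≡τ) , _) est =
      cong (λ e → ⟦ div ⟧ e e) (m≤n⇒m∸n≡0 {h′ * K * n * out 1} {b₂ * out 0} (begin
        h′ * K * n * out 1                     ≤⟨ *-monoˡ-≤ (out 1) (+-cancelʳ-≤ ((3 + δ) * N) (h′ * K * n) (b₂ * τ) cost) ⟩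
        b₂ * τ * out 1                         ≡⟨ *-assoc b₂ τ (out 1) ⟩
        b₂ * (τ * out 1)                       ≤⟨ *-monoʳ-≤ b₂ lower ⟩
        b₂ * out 0                             ∎))
      where
      open Estimate est
      open ≤-Reasoning
      2≤N : 2 ≤ N
      2≤N = ≤-trans (s≤s (s≤s z≤n)) (m≤n*m K n {{>-nonZero 1≤n}})
      expand : ∀ δ n → (5 + 3 * δ) * ((6 + 3 * δ) * 2) * n + (3 + δ) * (n * ((6 + 3 * δ) * 2))
                       ≡ (4 + (δ + δ)) * (2 * (n * ((6 + 3 * δ) * 2)))
      expand = solve-∀
      pull : ∀ b τ h m → b * (τ + 4 * (h * m)) ≡ b * τ + h * (4 * b * m)
      pull = solve-∀
      halve : ∀ h δ n → h * ((2 + (4 + (δ + δ))) * n) ≡ (3 + δ) * (n * (h * 2))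
      halve = solve-∀
      -- The term (3 + δ) N equals 4 b₂ h m, the total saving by steps of length 1 scaled by b₂;
      -- adding it to both sides avoids truncated subtraction.
      cost : h′ * K * n + (3 + δ) * N ≤ b₂ * τ + (3 + δ) * N
      cost = begin
        h′ * K * n + (3 + δ) * N                   ≡⟨ expand δ n ⟩
        b₂ * (2 * N)                               ≤⟨ *-monoʳ-≤ b₂ (blowup-lower E (suc h′) 2≤N isμ π) ⟩
        b₂ * (tourCost d π + 4 * (suc h′ * m))     ≡⟨ cong (λ z → b₂ * (z + 4 * (suc h′ * m))) cost≡τ ⟩
        b₂ * (τ + 4 * (suc h′ * m))                ≡⟨ pull b₂ τ (suc h′) m ⟩
        b₂ * τ + suc h′ * (4 * b₂ * m)             ≡⟨ cong (λ z → b₂ * τ + suc h′ * z) (small-size {n} {m} size) ⟩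
        b₂ * τ + suc h′ * ((2 + b₂) * n)           ≡⟨ cong (λ z → b₂ * τ + z) (halve (suc h′) δ n) ⟩
        b₂ * τ + (3 + δ) * N                       ∎

  module _ {p : ℚ} (A : Algorithm p (TSPEstimation (ℤ.+ 3 / 2 ℚ.- ε₀))) where
    open Algorithm A using (program; c; T; time; halts; correct)
    open Problem (MatchingGap ε) using (Instance; Correct; oracle)

    -- The function is `space` at W = (nK + 2) ^ c, so the exponent found here is directly the
    -- word-size exponent of the reduction.
    room : PolyBounded λ n → (n * K + 2) ^ c + (2 + (K + ((n * K + n * K) + (b₂ * suc ((n * K + 2) ^ c + n * K + 2)
                                       + (h′ * K * n) * suc ((n * K + 2) ^ c + n * K + 2) + (b₂ + h′ * K)))))
    room = poly-+ W (poly-+ (poly-const 2) (poly-+ (poly-const K) (poly-+ (poly-+ N N)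
             (poly-+ (poly-+ (poly-* (poly-const b₂) B) (poly-* (poly-* (poly-const (h′ * K)) poly-id) B))
                     (poly-const (b₂ + h′ * K))))))
      where
      N = poly-* poly-id (poly-const K)
      W = poly-^ c (poly-+ N (poly-const 2))
      B = poly-+ (poly-const 1) (poly-+ (poly-+ W N) (poly-const 2))

    -- 24 T + 9, as a sum that splits the coins into those of the estimator and
    -- unused ones.
    T′ : ℕ → ℕ
    T′ n = T (n * K) + (T (n * K) * 23 + 9)

    instanceTSP : ∀ {n} → Instance n → Problem.Instance (TSPEstimation (ℤ.+ 3 / 2 ℚ.- ε₀)) (n * K)
    instanceTSP {n} (1≤n , E , _) =
      ≤-trans (s≤s (s≤s (s≤s z≤n))) (m≤n*m K n {{>-nonZero 1≤n}}) , blowup E (suc h′)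

    Halts′ : ∀ {n} → Instance n → ((ℕ → ℕ) → Set) → Vec Bool (T′ n) → Set
    Halts′ {n} I Good ω =
      ∃[ s ] ∃[ t ] Run (oracle I) ((n + 2) ^ proj₁ room) (reduction K b₂ (h′ * K) program) (init n (toList ω)) s t
                    × t ≤ T′ n × Good (regs s)

    -- Generic in the property of the output, so that it yields both termination on all coins and
    -- correctness on the good ones.
    transfer : ∀ {n} (I : Instance n) {Good Good′ : (ℕ → ℕ) → Set} →
               (∀ out out′ → out′ 0 ≡ verdict b₂ (h′ * K) n out → Good out → Good′ out′) →
               ∀ ω ω′ → Algorithm.HaltsWith A (instanceTSP I) Good ω → Halts′ I Good′ (ω ++ ω′)
    transfer {n} I@(_ , E , _) {Good} {Good′} good ω ω′ (s , t , run , t≤ , g) =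
      conclude (reduction-run E h′ b₂ (h′ * K) (proj₂ room n) (toList ω′) run)
      where
      steps : ∀ t → t * 24 + 9 ≡ t + (t * 23 + 9)
      steps = solve-∀
      conclude : ∃[ s′ ] ∃[ t′ ] Run (oracle I) ((n + 2) ^ proj₁ room) (reduction K b₂ (h′ * K) program)
                                     (init n (toList ω List.++ toList ω′)) s′ t′
                                 × t′ ≤ t * 24 + 9 × regs s′ 0 ≡ verdict b₂ (h′ * K) n (regs s) →
                 Halts′ I Good′ (ω ++ ω′)
      conclude (s′ , t′ , run′ , t′≤ , out≡) =
        s′ , t′ ,
        subst (λ l → Run (oracle I) ((n + 2) ^ proj₁ room) (reduction K b₂ (h′ * K) program) (init n l) s′ t′)
              (sym (Vec.toList-++ ω ω′)) run′ ,
        ≤-trans t′≤ (≤-trans (+-monoˡ-≤ 9 (*-monoˡ-≤ 24 t≤)) (≤-reflexive (steps (T (n * K))))) ,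
        good (regs s) (regs s′) out≡ g

    distinguish : Algorithm p (MatchingGap ε)
    distinguish = record
      { program = reduction K b₂ (h′ * K) program
      ; c       = proj₁ room
      ; T       = T′
      ; time    = almostLinear-rescale 33 K T′≤ time
      ; halts   = λ {n} I ω → subst (Halts′ I (λ _ → ⊤)) (Vec.take++drop≡id (T (n * K)) ω)
                    (transfer I {λ _ → ⊤} {λ _ → ⊤} (λ _ _ _ _ → tt) (take (T (n * K)) ω) (drop (T (n * K)) ω)
                              (halts (instanceTSP I) (take (T (n * K)) ω)))
      ; correct = λ {n} I → ProbAtLeast-++ {p} {T (n * K)} {T (n * K) * 23 + 9}
                    (transfer I {Problem.Correct (TSPEstimation (ℤ.+ 3 / 2 ℚ.- ε₀)) (instanceTSP I)} {Correct I} (sound I)) (correct (instanceTSP I))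
      }
      where
      -- T may vanish, so the 9 steps of preparation and decision are charged to the maximum with 1;
      -- 33 = 24 + 9.
      T′≤ : ∀ n → T′ n ≤ 33 * (T (n * K) ⊔ 1)
      T′≤ n = ≤-trans (+-mono-≤ (m≤m⊔n (T (n * K)) 1) (+-mono-≤ (*-monoˡ-≤ 23 (m≤m⊔n (T (n * K)) 1))
                         (*-monoʳ-≤ 9 (m≤n⊔m (T (n * K)) 1))))
                      (≤-reflexive (total (T (n * K) ⊔ 1)))
        where
        total : ∀ t → t + (t * 23 + 9 * t) ≡ 33 * t
        total = solve-∀
      sound : ∀ {n} (I : Instance n) out out′ → out′ 0 ≡ verdict b₂ (h′ * K) n out →
              Problem.Correct (TSPEstimation (ℤ.+ 3 / 2 ℚ.- ε₀)) (instanceTSP I) out → Correct I out′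
      sound (1≤n , E , _) out out′ out≡ (τ , optimal , nz , τ≤ , ≤τ) =
        (λ perfect → trans out≡ (verdict-perfect E {τ} {out} 1≤n perfect optimal (estimate {τ} {out 0} {out 1} nz τ≤ ≤τ))) ,
        (λ small → trans out≡ (verdict-small E {τ} {out} 1≤n small optimal (estimate {τ} {out 0} {out 1} nz τ≤ ≤τ)))

open import Data.Integer using (+_)

theorem11p5 : ∀ (ε₀ : ℚ) → 0ℚ ℚ.< ε₀ → ε₀ ℚ.≤ + 1 / 4 →
    ∃[ ε ] 0ℚ ℚ.< ε × ε ℚ.< ½ ×
    (∀ (p : ℚ) → ½ ℚ.< p → p ℚ.≤ 1ℚ →
    Algorithm p (TSPEstimation (+ 3 / 2 ℚ.- ε₀)) →
    Algorithm p (MatchingGap ε))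
theorem11p5 ε₀ 0<ε₀ _ = ε , 0<ε , ε<½ , λ p _ _ A → distinguish A
  where open Gap ε₀ 0<ε₀
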